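{- Let $D=\mathbb{Z}[\omega]$ with $\omega=\frac{ -1+i\sqrt{3}}{2}$, and let $\pi\in D$ be a primary prime with $N\pi\neq 3$. If $\pi=q$ is a rational prime, write $q=3m-1$ with $m\in\mathbb{Z}$; if $\pi=a+b\omega$ is a (non-rational) primary prime with $a,b\in\mathbb{Z}$, write $a=3m-1$ with $m\in\mathbb{Z}$. Then $$\chi_\pi(1-\omega)=\omega^{2m}.$$
   Context: For $\alpha=a+b\omega\in D$ with $a,b\in\mathbb{Z}$, the norm is $N\alpha=\alpha\overline{\alpha}=a^2-ab+b^2$. A prime $\pi\in D$ is called primary if $\pi\equiv 2\pmod 3$ in $D$ (i.e. $\pi=a+b\omega$ with $a\equiv 2$, $b\equiv 0\pmod 3$). A rational prime is a prime of $\mathbb{Z}$. For a prime $\pi\in D$ with $N\pi\ne 3$, the cubic residue character $\chi_\pi$ on $D$ is defined by: $\chi_\pi(\alpha)=0$ if $\pi\mid\alpha$; otherwise $\chi_\pi(\alpha)$ is the unique element of $\{1,\omega,\omega^2\}$ with $\alpha^{(N\pi-1)/3}\equiv\chi_\pi(\alpha)\pmod{\pi}$. -}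

module Defs where

open import Algebra.Bundles using (CommutativeRing; RawSemiring; Semiring)
import Algebra.Definitions.RawMagma as MagmaDefinitions
import Algebra.Definitions.RawSemiring as SemiringDefinitions
open import Data.Integer.Base as ℤ using (ℤ; +_; -[1+_]; 0ℤ; 1ℤ; ∣_∣)
open import Data.Integer.Divisibility.Signed as ℤᵈ using (divides)
import Data.Integer.Properties as ℤ
open import Data.Integer.Tactic.RingSolver using (solve-∀)
open import Data.Nat.Base as ℕ using (ℕ; suc)
import Data.Nat.Divisibility as ℕ
import Data.Nat.DivMod as ℕ
import Data.Nat.Properties as ℕ
open import Data.Nat.Primality using (prime?; prime⇒irreducible)
open import Data.Product.Base using (_×_; _,_; ∃-syntax)
open import Data.Sum.Base using (_⊎_; inj₁; inj₂)
open import Level using (0ℓ)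
open import Relation.Binary.Definitions using (DecidableEquality)
open import Relation.Binary.PropositionalEquality
  using (_≡_; _≢_; refl; sym; trans; cong; cong₂; subst; isEquivalence; module ≡-Reasoning)
open import Relation.Nullary.Decidable using (Dec; yes; no; map′; _×-dec_; from-yes)
open import Relation.Nullary.Negation using (contradiction)

private module Identities where
  open import Data.Integer.Base using (_+_; _*_; _-_; -_)

  assoc₁ : ∀ a b c d e f →
    (a * c - b * d) * e - (a * d + b * c - b * d) * f ≡
    a * (c * e - d * f) - b * (c * f + d * e - d * f)
  assoc₁ = solve-∀
  assoc₂ : ∀ a b c d e f →
    (a * c - b * d) * f + (a * d + b * c - b * d) * e - (a * d + b * c - b * d) * f ≡
    a * (c * f + d * e - d * f) + b * (c * e - d * f) - b * (c * f + d * e - d * f)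
  assoc₂ = solve-∀
  idˡ₁ : ∀ a b → 1ℤ * a - 0ℤ * b ≡ a
  idˡ₁ = solve-∀
  idˡ₂ : ∀ a b → 1ℤ * b + 0ℤ * a - 0ℤ * b ≡ b
  idˡ₂ = solve-∀
  idʳ₁ : ∀ a b → a * 1ℤ - b * 0ℤ ≡ a
  idʳ₁ = solve-∀
  idʳ₂ : ∀ a b → a * 0ℤ + b * 1ℤ - b * 0ℤ ≡ b
  idʳ₂ = solve-∀
  distˡ₁ : ∀ a b c d e f →
    a * (c + e) - b * (d + f) ≡ (a * c - b * d) + (a * e - b * f)
  distˡ₁ = solve-∀
  distˡ₂ : ∀ a b c d e f →
    a * (d + f) + b * (c + e) - b * (d + f) ≡
    (a * d + b * c - b * d) + (a * f + b * e - b * f)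
  distˡ₂ = solve-∀
  distʳ₁ : ∀ a b c d e f →
    (c + e) * a - (d + f) * b ≡ (c * a - d * b) + (e * a - f * b)
  distʳ₁ = solve-∀
  distʳ₂ : ∀ a b c d e f →
    (c + e) * b + (d + f) * a - (d + f) * b ≡
    (c * b + d * a - d * b) + (e * b + f * a - f * b)
  distʳ₂ = solve-∀
  comm₁ : ∀ a b c d → a * c - b * d ≡ c * a - d * b
  comm₁ = solve-∀
  comm₂ : ∀ a b c d → a * d + b * c - b * d ≡ c * b + d * a - d * b
  comm₂ = solve-∀
  conj₁ : ∀ a b → a * (a - b) - b * (- b) ≡ a * a - a * b + b * b
  conj₁ = solve-∀
  conj₂ : ∀ a b → a * (- b) + b * (a - b) - b * (- b) ≡ 0ℤ
  conj₂ = solve-∀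
  norm-* : ∀ a b c d →
    (a * c - b * d) * (a * c - b * d) - (a * c - b * d) * (a * d + b * c - b * d)
      + (a * d + b * c - b * d) * (a * d + b * c - b * d)
    ≡ (a * a - a * b + b * b) * (c * c - c * d + d * d)
  norm-* = solve-∀

infix  5 _+ω·_
infixl 7 _*_
infixl 6 _+_ _-_
infix  8 -_

-- ℤ[ω] as the free ℤ-module on 1 and ω, where ω² = -1 - ω.
record D : Set where
  constructor _+ω·_
  field
    re im : ℤ
open D public

fromℤ : ℤ → D
fromℤ a = a +ω· 0ℤ

0D 1D ω : D
0D = fromℤ 0ℤ
1D = fromℤ 1ℤ
ω  = 0ℤ +ω· 1ℤ

_+_ _*_ : D → D → D
(a +ω· b) + (c +ω· d) = a ℤ.+ c +ω· b ℤ.+ d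
(a +ω· b) * (c +ω· d) = a ℤ.* c ℤ.- b ℤ.* d +ω· a ℤ.* d ℤ.+ b ℤ.* c ℤ.- b ℤ.* d

-_ : D → D
- (a +ω· b) = ℤ.- a +ω· ℤ.- b

_-_ : D → D → D
α - β = α + - β

D-commutativeRing : CommutativeRing 0ℓ 0ℓ
D-commutativeRing = record
  { Carrier = D ; _≈_ = _≡_ ; _+_ = _+_ ; _*_ = _*_ ; -_ = λ α → - α ; 0# = 0D ; 1# = 1D
  ; isCommutativeRing = record
    { isRing = record
      { +-isAbelianGroup = record
        { isGroup = record
          { isMonoid = record
            { isSemigroup = record
              { isMagma = record { isEquivalence = isEquivalence ; ∙-cong = cong₂ _+_ }
              ; assoc = λ where
                  (a +ω· b) (c +ω· d) (e +ω· f) →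
                    cong₂ _+ω·_ (ℤ.+-assoc a c e) (ℤ.+-assoc b d f)
              }
            ; identity =
                (λ where (a +ω· b) → cong₂ _+ω·_ (ℤ.+-identityˡ a) (ℤ.+-identityˡ b))
              , (λ where (a +ω· b) → cong₂ _+ω·_ (ℤ.+-identityʳ a) (ℤ.+-identityʳ b))
            }
          ; inverse =
              (λ where (a +ω· b) → cong₂ _+ω·_ (ℤ.+-inverseˡ a) (ℤ.+-inverseˡ b))
            , (λ where (a +ω· b) → cong₂ _+ω·_ (ℤ.+-inverseʳ a) (ℤ.+-inverseʳ b))
          ; ⁻¹-cong = cong (λ α → - α)
          }
        ; comm = λ where
            (a +ω· b) (c +ω· d) → cong₂ _+ω·_ (ℤ.+-comm a c) (ℤ.+-comm b d)
        }
      ; *-cong = cong₂ _*_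
      ; *-assoc = λ where
          (a +ω· b) (c +ω· d) (e +ω· f) → cong₂ _+ω·_ (assoc₁ a b c d e f) (assoc₂ a b c d e f)
      ; *-identity =
          (λ where (a +ω· b) → cong₂ _+ω·_ (idˡ₁ a b) (idˡ₂ a b))
        , (λ where (a +ω· b) → cong₂ _+ω·_ (idʳ₁ a b) (idʳ₂ a b))
      ; distrib =
          (λ where (a +ω· b) (c +ω· d) (e +ω· f) →
                     cong₂ _+ω·_ (distˡ₁ a b c d e f) (distˡ₂ a b c d e f))
        , (λ where (a +ω· b) (c +ω· d) (e +ω· f) →
                     cong₂ _+ω·_ (distʳ₁ a b c d e f) (distʳ₂ a b c d e f))
      }
    ; *-comm = λ where (a +ω· b) (c +ω· d) → cong₂ _+ω·_ (comm₁ a b c d) (comm₂ a b c d)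
    }
  }
  where open Identities

module Dᵣ = CommutativeRing D-commutativeRing

open SemiringDefinitions (Semiring.rawSemiring Dᵣ.semiring) public
  using (_∣_; _∤_; _^_; Prime; mkPrime)
open MagmaDefinitions (RawSemiring.*-rawMagma (Semiring.rawSemiring Dᵣ.semiring)) public
  using (_,_)

RationalPrime : ℤ → Set
RationalPrime = SemiringDefinitions.Prime (Semiring.rawSemiring ℤ.+-*-semiring)

IsRationalPrime : D → Set
IsRationalPrime π = ∃[ q ] RationalPrime q × π ≡ fromℤ q

infix 4 _≡_[mod_]
_≡_[mod_] : D → D → D → Set
α ≡ β [mod γ ] = γ ∣ α - β

Primary : D → Set
Primary π = π ≡ fromℤ (+ 2) [mod fromℤ (+ 3) ]

-- Complex conjugation exchanges ω and ω² = -1 - ω.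
conj : D → D
conj (a +ω· b) = a ℤ.- b +ω· ℤ.- b

N : D → ℤ
N (a +ω· b) = a ℤ.* a ℤ.- a ℤ.* b ℤ.+ b ℤ.* b

α*conj≡N : ∀ α → α * conj α ≡ fromℤ (N α)
α*conj≡N (a +ω· b) = cong₂ _+ω·_ (conj₁ a b) (conj₂ a b)
  where open Identities

-- Integer powers of ω, using ω⁻¹ = ω².
infixr 8 ω^_
ω^_ : ℤ → D
ω^ (+ n)    = ω ^ n
ω^ -[1+ n ] = (ω ^ 2) ^ suc n

ω²*ω≡1 : ω ^ 2 * ω ≡ 1D
ω²*ω≡1 = refl

infix 4 _≟_ _∣?_

_≟_ : DecidableEquality D
(a +ω· b) ≟ (c +ω· d) =
  map′ (λ (p , q) → cong₂ _+ω·_ p q) (λ p → cong re p , cong im p)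
       (a ℤ.≟ c ×-dec b ℤ.≟ d)

square : ∀ x → x ℤ.* x ≡ + (∣ x ∣ ℕ.* ∣ x ∣)
square (+ n)    = sym (ℤ.pos-* n n)
square -[1+ n ] = refl

4N : ∀ α → (+ 2 ℤ.* re α ℤ.- im α) ℤ.* (+ 2 ℤ.* re α ℤ.- im α) ℤ.+ + 3 ℤ.* (im α ℤ.* im α)
           ≡ + 4 ℤ.* N α
4N (a +ω· b) = eq a b
  where
  eq : ∀ a b → (+ 2 ℤ.* a ℤ.- b) ℤ.* (+ 2 ℤ.* a ℤ.- b) ℤ.+ + 3 ℤ.* (b ℤ.* b)
             ≡ + 4 ℤ.* (a ℤ.* a ℤ.- a ℤ.* b ℤ.+ b ℤ.* b)
  eq = solve-∀

N-nonneg : ∀ α → N α ≡ + ∣ N α ∣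
N-nonneg α with N α | 4N α
... | + _      | _ = refl
... | -[1+ _ ] | eq
  rewrite square (+ 2 ℤ.* re α ℤ.- im α) | square (im α)
        | sym (ℤ.pos-* 3 (∣ im α ∣ ℕ.* ∣ im α ∣)) with () ← eq

N≡0⇒≡0 : ∀ α → N α ≡ 0ℤ → α ≡ 0D
N≡0⇒≡0 (a +ω· b) N≡0 =
  cong₂ _+ω·_
    (vanish (+ 2 ℤ.* b ℤ.- a) a (trans (eq₂ a b) (cong (+ 4 ℤ.*_) N≡0)))
    (vanish (+ 2 ℤ.* a ℤ.- b) b (trans (4N (a +ω· b)) (cong (+ 4 ℤ.*_) N≡0)))
  where
  eq₂ : ∀ a b → (+ 2 ℤ.* b ℤ.- a) ℤ.* (+ 2 ℤ.* b ℤ.- a) ℤ.+ + 3 ℤ.* (a ℤ.* a)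
              ≡ + 4 ℤ.* (a ℤ.* a ℤ.- a ℤ.* b ℤ.+ b ℤ.* b)
  eq₂ = solve-∀
  vanish : ∀ x y → x ℤ.* x ℤ.+ + 3 ℤ.* (y ℤ.* y) ≡ 0ℤ → y ≡ 0ℤ
  vanish x y eq rewrite square x | square y | sym (ℤ.pos-* 3 (∣ y ∣ ℕ.* ∣ y ∣))
    with ℕ.m*n≡0⇒m≡0∨n≡0 3 (ℕ.m+n≡0⇒n≡0 (∣ x ∣ ℕ.* ∣ x ∣) (ℤ.+-injective eq))
  ... | inj₂ y²≡0 with ℕ.m*n≡0⇒m≡0∨n≡0 ∣ y ∣ y²≡0
  ...   | inj₁ p = ℤ.∣i∣≡0⇒i≡0 p
  ...   | inj₂ p = ℤ.∣i∣≡0⇒i≡0 p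

-- For π ≠ 0, π ∣ α iff N π divides both coordinates of α * conj π.
_∣?_ : ∀ π α → Dec (π ∣ α)
π ∣? α with π ≟ 0D
... | yes refl = map′ (λ p → 0D , sym p) (λ (β , p) → trans (sym p) (Dᵣ.zeroʳ β)) (α ≟ 0D)
... | no π≢0 =
  map′ (λ (p , q) → to p q) (λ p → from p)
       (N π ℤᵈ.∣? re (α * conj π) ×-dec N π ℤᵈ.∣? im (α * conj π))
  where
  open ≡-Reasoning
  instance
    N≢0 : ℤ.NonZero (N π)
    N≢0 = ℤ.≢-nonZero (λ p → π≢0 (N≡0⇒≡0 π p))
  scale₁ : ∀ x y n → x ℤ.* n ℤ.- y ℤ.* 0ℤ ≡ x ℤ.* n
  scale₁ = solve-∀
  scale₂ : ∀ x y n → x ℤ.* 0ℤ ℤ.+ y ℤ.* n ℤ.- y ℤ.* 0ℤ ≡ y ℤ.* n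
  scale₂ = solve-∀
  scale : ∀ γ n → γ * fromℤ n ≡ (re γ ℤ.* n +ω· im γ ℤ.* n)
  scale (x +ω· y) n = cong₂ _+ω·_ (scale₁ x y n) (scale₂ x y n)
  cancel : ∀ β γ → β * fromℤ (N π) ≡ γ * fromℤ (N π) → β ≡ γ
  cancel β γ eq = cong₂ _+ω·_
    (ℤ.*-cancelʳ-≡ (re β) (re γ) (N π) (cong re eq′))
    (ℤ.*-cancelʳ-≡ (im β) (im γ) (N π) (cong im eq′))
    where eq′ = trans (sym (scale β (N π))) (trans eq (scale γ (N π)))
  α*N : ∀ β → β * π * conj π ≡ β * fromℤ (N π)
  α*N β = trans (Dᵣ.*-assoc β π (conj π)) (cong (β *_) (α*conj≡N π))
  to : N π ℤᵈ.∣ re (α * conj π) → N π ℤᵈ.∣ im (α * conj π) → π ∣ α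
  to (divides x p) (divides y q) = γ , cancel (γ * π) α (begin
    γ * π * fromℤ (N π)     ≡⟨ Dᵣ.*-assoc γ π _ ⟩
    γ * (π * fromℤ (N π))   ≡⟨ cong (γ *_) (Dᵣ.*-comm π _) ⟩
    γ * (fromℤ (N π) * π)   ≡⟨ Dᵣ.*-assoc γ _ π ⟨
    γ * fromℤ (N π) * π     ≡⟨ cong (_* π) (trans (cong₂ _+ω·_ p q) (sym (scale γ (N π)))) ⟨
    α * conj π * π          ≡⟨ Dᵣ.*-assoc α _ π ⟩
    α * (conj π * π)        ≡⟨ cong (α *_) (Dᵣ.*-comm (conj π) π) ⟩
    α * (π * conj π)        ≡⟨ cong (α *_) (α*conj≡N π) ⟩
    α * fromℤ (N π)         ∎)
    where γ = x +ω· y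
  from : π ∣ α → N π ℤᵈ.∣ re (α * conj π) × N π ℤᵈ.∣ im (α * conj π)
  from (β , refl) = divides (re β) (cong re eq) , divides (im β) (cong im eq)
    where eq = trans (α*N β) (scale β (N π))

-- For prime π with N π ≠ 3 one has N π ≡ 1 (mod 3), so the division is exact.
cubicExponent : D → ℕ
cubicExponent π = (∣ N π ∣ ℕ.∸ 1) ℕ./ 3

-- The search may return the first match, since by χ-unique there is at most
-- one. The final 0D is a junk value, reached only if no cube root of unity is
-- congruent to the power, which does not happen for prime π with N π ≠ 3.
χ : D → D → D
χ π α with π ∣? α
... | yes _ = 0D
... | no _ with π ∣? (α ^ cubicExponent π - 1D)
...   | yes _ = 1D
...   | no _ with π ∣? (α ^ cubicExponent π - ω)
...     | yes _ = ω
...     | no _ with π ∣? (α ^ cubicExponent π - ω ^ 2)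
...       | yes _ = ω ^ 2
...       | no _ = 0D

CubeRootOfUnity : D → Set
CubeRootOfUnity γ = γ ≡ 1D ⊎ γ ≡ ω ⊎ γ ≡ ω ^ 2

N-* : ∀ α β → N (α * β) ≡ N α ℤ.* N β
N-* (a +ω· b) (c +ω· d) = Identities.norm-* a b c d

residue-unique : ∀ {π} x γ δ → Prime π → N π ≢ + 3 →
                 CubeRootOfUnity γ → CubeRootOfUnity δ →
                 x ≡ γ [mod π ] → x ≡ δ [mod π ] → γ ≡ δ
residue-unique {π} x γ δ π-prime Nπ≢3 γ³ δ³ (β , p) (β′ , q) = cases γ³ δ³
  where
  difference : ∀ x γ δ → (x - γ) - (x - δ) ≡ δ - γ
  difference (x +ω· x′) (a +ω· b) (c +ω· d) = cong₂ _+ω·_ (eq x a c) (eq x′ b d)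
    where
    eq : ∀ x a c → (x ℤ.+ ℤ.- a) ℤ.+ ℤ.- (x ℤ.+ ℤ.- c) ≡ c ℤ.+ ℤ.- a
    eq = solve-∀
  factor : ∀ x y z → (x - y) * z ≡ x * z - y * z
  factor x y z = trans (Dᵣ.distribʳ z x (- y)) (cong (λ t → x * z + t) (sym (-‿distribˡ-* y z)))
    where open import Algebra.Properties.Ring Dᵣ.ring using (-‿distribˡ-*)
  π∣δ-γ : (β - β′) * π ≡ δ - γ
  π∣δ-γ = trans (factor β β′ π) (trans (cong₂ _-_ p q) (difference x γ δ))
  ∣Nπ∣≡ : ∀ {n} → ∣ N π ∣ ≡ n → N π ≡ + n
  ∣Nπ∣≡ p = trans (N-nonneg π) (cong +_ p)
  absurd : N (δ - γ) ≢ + 3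
  absurd N≡3 with ∣-prime (subst (∣ N π ∣ ℕ.∣_) ∣N∣≡3 ∣N∣-divides)
    where
    ∣N∣≡3 : ∣ N (δ - γ) ∣ ≡ 3
    ∣N∣≡3 = cong ∣_∣ N≡3
    ∣N∣-divides : ∣ N π ∣ ℕ.∣ ∣ N (δ - γ) ∣
    ∣N∣-divides = ℕ.divides ∣ N (β - β′) ∣
      (trans (cong (λ z → ∣ N z ∣) (sym π∣δ-γ))
        (trans (cong ∣_∣ (N-* (β - β′) π)) (ℤ.abs-* (N (β - β′)) (N π))))
    ∣-prime : ∀ {n} → n ℕ.∣ 3 → n ≡ 1 ⊎ n ≡ 3
    ∣-prime = prime⇒irreducible (from-yes (prime? 3))
  ... | inj₁ N≡1 = Prime.p∤1 π-prime (conj π , trans (Dᵣ.*-comm (conj π) π)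
                     (trans (α*conj≡N π) (cong fromℤ (∣Nπ∣≡ N≡1))))
  ... | inj₂ N≡3 = Nπ≢3 (∣Nπ∣≡ N≡3)
  cases : CubeRootOfUnity γ → CubeRootOfUnity δ → γ ≡ δ
  cases (inj₁ refl)        (inj₁ refl)        = refl
  cases (inj₁ refl)        (inj₂ (inj₁ refl)) = contradiction refl absurd
  cases (inj₁ refl)        (inj₂ (inj₂ refl)) = contradiction refl absurd
  cases (inj₂ (inj₁ refl)) (inj₁ refl)        = contradiction refl absurd
  cases (inj₂ (inj₁ refl)) (inj₂ (inj₁ refl)) = refl
  cases (inj₂ (inj₁ refl)) (inj₂ (inj₂ refl)) = contradiction refl absurd
  cases (inj₂ (inj₂ refl)) (inj₁ refl)        = contradiction refl absurd
  cases (inj₂ (inj₂ refl)) (inj₂ (inj₁ refl)) = contradiction refl absurd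
  cases (inj₂ (inj₂ refl)) (inj₂ (inj₂ refl)) = refl

χ-zero : ∀ {π α} → π ∣ α → χ π α ≡ 0D
χ-zero {π} {α} π∣α with π ∣? α
... | yes _  = refl
... | no π∤α = contradiction π∣α π∤α

χ-unique : ∀ {π α γ} → Prime π → N π ≢ + 3 → π ∤ α → CubeRootOfUnity γ →
           α ^ cubicExponent π ≡ γ [mod π ] → χ π α ≡ γ
χ-unique {π} {α} {γ} π-prime Nπ≢3 π∤α γ³ αᵏ≡γ with π ∣? α
... | yes π∣α = contradiction π∣α π∤α
... | no _ with π ∣? (α ^ cubicExponent π - 1D)
...   | yes r = residue-unique (α ^ cubicExponent π) 1D γ π-prime Nπ≢3 (inj₁ refl) γ³ r αᵏ≡γ
...   | no ¬1 with π ∣? (α ^ cubicExponent π - ω)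
...     | yes r = residue-unique (α ^ cubicExponent π) ω γ π-prime Nπ≢3 (inj₂ (inj₁ refl)) γ³ r αᵏ≡γ
...     | no ¬ω with π ∣? (α ^ cubicExponent π - ω ^ 2)
...       | yes r = residue-unique (α ^ cubicExponent π) (ω ^ 2) γ π-prime Nπ≢3 (inj₂ (inj₂ refl)) γ³ r αᵏ≡γ
...       | no ¬ω² with γ³
...         | inj₁ refl        = contradiction αᵏ≡γ ¬1
...         | inj₂ (inj₁ refl) = contradiction αᵏ≡γ ¬ω
...         | inj₂ (inj₂ refl) = contradiction αᵏ≡γ ¬ω²

module Submission where

-- Let K = ℤ[ω]/π, with N π = 3M + 1 elements, and let J = ∑ χ(x) χ(1 - x) be
-- the Jacobi sum of χ = χ_π over K. Summing χ(z - 1)(1 + χ(z) + χ(z)²) over K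
-- gives J = 2 + 3T, where T = ∑ χ(z - 1) over the z ≠ 1 with χ(z) = 1. These z
-- are the M - 1 roots of 1 + X + ⋯ + X^(M-1), so the product of the 1 - z is M.
-- Since a sum of n cube roots of unity is n - 1 plus their product modulo 3,
-- J ≡ 2 + 3(M - 2 + χ(M)) modulo 9. Moreover N J = N π, and π ∣ J because
-- J ≡ ∑ x^M (1 - x)^M is a sum of monomials of degree less than N π - 1. Both J
-- and π are ≡ 2 modulo 3, hence J = π. Since 3M ≡ - 1 modulo π and
-- 3 = - ω²(1 - ω)², χ(M) = ω^M χ(1 - ω), and comparing π with J modulo 9 gives
-- χ(1 - ω).

open import Algebra.Bundles using (CommutativeMonoid; CommutativeRing)
import Algebra.Properties.CommutativeMonoid.Sum as CommutativeMonoidSum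
open import Data.Bool.Base using (Bool; true; false; if_then_else_)
open import Data.Fin.Base
  using (Fin; zero; suc; toℕ; fromℕ<; combine; remQuot; punchIn; punchOut)
open import Data.Fin.Permutation using (Permutation′; permutation; _⟨$⟩ʳ_)
open import Data.Fin.Properties
  using ( any?; punchInᵢ≢i; punchOut-injective; injective⇒≤; suc-injective
        ; toℕ<n; toℕ-fromℕ<; toℕ-injective; remQuot-combine; combine-remQuot)
import Data.Fin.Properties as Fin
open import Data.Integer.Base as ℤ using (ℤ; +_; -[1+_]; 0ℤ; 1ℤ; ∣_∣)
import Data.Integer.DivMod as ℤ
open import Data.Integer.Divisibility.Signed as ℤᵈ using (divides)
import Data.Integer.Properties as ℤ
import Data.Integer.Tactic.RingSolver as ℤ-Solver
open import Data.Nat.Base as ℕ using (ℕ; zero; suc)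
import Data.Nat.Divisibility as ℕ
import Data.Nat.DivMod as ℕ
open import Data.Nat.GCD using (mkGCD; module GCD; module Bézout)
import Data.Nat.Properties as ℕ
open import Data.Product.Base using (_×_; _,_; ∃-syntax; Σ-syntax; proj₁; proj₂; uncurry)
open import Data.Sum.Base as ⊎ using (_⊎_; inj₁; inj₂)
open import Data.Vec.Base using (Vec; []; _∷_; replicate)
open import Function.Base using (_∘_)
open import Function.Definitions using (Injective)
open import Level using (0ℓ)
open import Relation.Binary.PropositionalEquality
  using (_≡_; _≢_; refl; sym; trans; cong; cong₂; subst; module ≡-Reasoning)
open import Relation.Nullary.Decidable
  using ( Dec; yes; no; does; map′; dec⇒maybe; dec-true; dec-false; decidable-stable
        ; from-no; _×-dec_; ¬?)
open import Relation.Nullary.Negation using (¬_; contradiction)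
open import Tactic.RingSolver using (solve-∀)
open import Tactic.RingSolver.Core.AlmostCommutativeRing
  using (AlmostCommutativeRing; fromCommutativeRing)

-- The M of the overview is `suc M` below, so there are `M` factors 1 - z. Precision 9 is what the
-- answer requires: `J` = 2 + 3T then fixes T modulo 3, and distinct cube roots of unity stay
-- distinct modulo 3, so that χ(1 - ω) can be read off a congruence. The equality J = π comes from
-- the cofactor κ in κπ = J, which has norm 1 and is ≡ 1 modulo 3; the only such unit is 1. The
-- classical route to N J passes through Gauss sums, but their additive characters take values
-- outside ℤ[ω]. Here the self-convolutions of χ and of χ² are multiplied and summed over K.
-- Evaluated in two ways, this sum is n J J̄ and n(n + 1), where n = N π - 1. Split and inert primes
-- are treated alike: K has N π elements in both cases, and π = 2 + 3(r + sω) enters the final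
-- congruences only through r and s.

-- Integer arithmetic of the lattice πℤ[ω]

module IntegerArithmetic where
  open import Data.Integer.Base using (_+_; _*_; _-_; -_)

  -- The content `g` is split off because ℤ[ω] modulo a number with coprime coordinates is cyclic as
  -- an additive group, whereas modulo π it need not be: for a rational prime q it has q² elements,
  -- all killed by q.
  record Primitive (a b : ℤ) : Set where
    field
      g           : ℕ
      a′ b′ u v   : ℤ
      a≡          : a ≡ + g * a′
      b≡          : b ≡ + g * b′
      bézout      : u * a′ + v * b′ ≡ 1ℤ

  primitivePart : ∀ a b → ¬ (a ≡ 0ℤ × b ≡ 0ℤ) → Primitive a b
  primitivePart a b ≢0 with mkGCD ∣ a ∣ ∣ b ∣
  ... | g , isGCD with ℤᵈ.∣ᵤ⇒∣ {+ g} {a} (GCD.gcd∣m isGCD) | ℤᵈ.∣ᵤ⇒∣ {+ g} {b} (GCD.gcd∣n isGCD)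
  ... | divides a′ a≡ | divides b′ b≡ = record
    { g = g ; a′ = a′ ; b′ = b′ ; u = x * s ; v = y * t
    ; a≡ = trans a≡ (ℤ.*-comm a′ (+ g)) ; b≡ = trans b≡ (ℤ.*-comm b′ (+ g))
    ; bézout = ℤ.*-cancelˡ-≡ (+ g) _ _ (trans (regroup (+ g) x s a′ y t b′)
        (trans (cong₂ (λ p q → x * (s * p) + y * (t * q)) (sym a≡) (sym b≡))
          (trans (sym combination) (sym (ℤ.*-identityʳ (+ g))))))
    }
    where
    regroup : ∀ g x s a′ y t b′ → g * (x * s * a′ + y * t * b′) ≡ x * (s * (a′ * g)) + y * (t * (b′ * g))
    regroup = ℤ-Solver.solve-∀
    instance
      g≢0 : ℕ.NonZero g
      g≢0 = ℕ.≢-nonZero λ { refl →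
        ≢0 (trans a≡ (ℤ.*-zeroʳ a′) , trans b≡ (ℤ.*-zeroʳ b′)) }
    unsign : ∀ a → ∃[ s ] + ∣ a ∣ ≡ s * a
    unsign (+ n)    = 1ℤ , sym (ℤ.*-identityˡ (+ n))
    unsign -[1+ n ] = ℤ.-1ℤ , sym (ℤ.-1*i≡-i -[1+ n ])
    s = proj₁ (unsign a)
    t = proj₁ (unsign b)
    move : ∀ d e f → d + e ≡ f → d ≡ f + - e
    move d e f refl = eq d e
      where
      eq : ∀ d e → d ≡ d + e + - e
      eq = ℤ-Solver.solve-∀
    signed : Bézout.Identity g ∣ a ∣ ∣ b ∣ → ∃[ x ] ∃[ y ] + g ≡ x * + ∣ a ∣ + y * + ∣ b ∣
    signed (Bézout.+- x y eq) = + x , - + y , trans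
      (move (+ g) (+ y * + ∣ b ∣) (+ x * + ∣ a ∣)
        (trans (cong (λ z → + g + z) (sym (ℤ.pos-* y ∣ b ∣))) (trans (cong +_ eq) (ℤ.pos-* x ∣ a ∣))))
      (cong (λ z → + x * + ∣ a ∣ + z) (ℤ.neg-distribˡ-* (+ y) (+ ∣ b ∣)))
    signed (Bézout.-+ x y eq) = - + x , + y , trans
      (move (+ g) (+ x * + ∣ a ∣) (+ y * + ∣ b ∣)
        (trans (cong (λ z → + g + z) (sym (ℤ.pos-* x ∣ a ∣))) (trans (cong +_ eq) (ℤ.pos-* y ∣ b ∣))))
      (trans (ℤ.+-comm (+ y * + ∣ b ∣) _) (cong (λ z → z + + y * + ∣ b ∣) (ℤ.neg-distribˡ-* (+ x) (+ ∣ a ∣))))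
    coefficients = signed (Bézout.identity isGCD)
    x = proj₁ coefficients
    y = proj₁ (proj₂ coefficients)
    combination : + g ≡ x * (s * a) + y * (t * b)
    combination = trans (proj₂ (proj₂ coefficients))
      (cong₂ (λ p q → x * p + y * q) (proj₂ (unsign a)) (proj₂ (unsign b)))

  <∧∣-⇒≡ : ∀ {i j m} k → i ℕ.< m → j ℕ.< m → + i - + j ≡ k * + m → i ≡ j
  <∧∣-⇒≡ {i} {j} {m} k i<m j<m eq with ∣ + i - + j ∣ in d
  ... | zero = ℤ.+-injective (ℤ.i-j≡0⇒i≡j (+ i) (+ j) (ℤ.∣i∣≡0⇒i≡0 d))
  ... | n@(suc _) = contradiction (ℕ.divides ∣ k ∣ n≡) (ℕ.>⇒∤ n<m)
    where
    n≡ : n ≡ ∣ k ∣ ℕ.* m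
    n≡ = trans (sym d) (trans (cong ∣_∣ eq) (ℤ.abs-* k (+ m)))
    n<m : n ℕ.< m
    n<m = ℕ.≤-<-trans
      (ℕ.≤-trans (ℕ.≤-reflexive (trans (sym d) (cong ∣_∣ (ℤ.m-n≡m⊖n i j)))) (ℤ.∣m⊝n∣≤m⊔n i j))
      (ℕ.⊔-lub i<m j<m)

  -- The multiples of g(a′ + b′ω) form a lattice with the triangular basis g(t + ω), gν. Reduction
  -- first brings the coordinate of ω below g and then the real coordinate below gν.
  module Reduction {g a′ b′ u v : ℤ} (bézout : u * a′ + v * b′ ≡ 1ℤ) where

    -- (v + u) + uω times the primitive a′ + b′ω is t + ω.
    t : ℤ
    t = (v + u) * a′ - u * b′

    ν : ℤ
    ν = a′ * a′ - a′ * b′ + b′ * b′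

    -- Subtracting k times g(t + ω) and l times gν from x + yω amounts to adding the multiple of
    -- g(a′ + b′ω) by - (k((v + u) + uω) + l(a′ - b′ - b′ω)). The last bracket is the conjugate of
    -- a′ + b′ω, whose product with it is ν. This is the real coordinate, `reduce-im` the other one.
    reduce-re : ∀ x R k l → x + - (k * g * t) ≡ R + l * (g * ν) →
      - (k * (v + u) + l * (a′ - b′)) * (g * a′) - - (k * u + l * - b′) * (g * b′) ≡ R - x
    reduce-re x R k l eq = trans (lhs k l u v a′ b′ g)
      (sym (trans (cong (_- x) (sym (move R (l * (g * ν)) _ eq))) (rhs x (k * g * t) (l * (g * ν)))))
      where
      lhs : ∀ k l u v a b g →
        - (k * (v + u) + l * (a - b)) * (g * a) - - (k * u + l * - b) * (g * b) ≡
        - (k * g * ((v + u) * a - u * b)) - l * (g * (a * a - a * b + b * b))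
      lhs = ℤ-Solver.solve-∀
      move : ∀ R y z → z ≡ R + y → z - y ≡ R
      move R y _ refl = eq′ R y
        where
        eq′ : ∀ R y → R + y - y ≡ R
        eq′ = ℤ-Solver.solve-∀
      rhs : ∀ x y z → x + - y - z - x ≡ - y - z
      rhs = ℤ-Solver.solve-∀

    reduce-im : ∀ y R k l → y ≡ R + k * g →
      - (k * (v + u) + l * (a′ - b′)) * (g * b′) + - (k * u + l * - b′) * (g * a′)
        - - (k * u + l * - b′) * (g * b′) ≡ R - y
    reduce-im y R k l refl = trans (lhs k l u v a′ b′ g)
      (trans (cong (λ z → - (k * g) * z) bézout) (rhs R (k * g)))
      where
      lhs : ∀ k l u v a b g →
        - (k * (v + u) + l * (a - b)) * (g * b) + - (k * u + l * - b) * (g * a)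
          - - (k * u + l * - b) * (g * b) ≡ - (k * g) * (u * a + v * b)
      lhs = ℤ-Solver.solve-∀
      rhs : ∀ R y → - y * 1ℤ ≡ R - (R + y)
      rhs = ℤ-Solver.solve-∀

    multiple-im : ∀ {y} p q → p * (g * b′) + q * (g * a′) - q * (g * b′) ≡ y →
                  y ≡ (p * b′ + q * a′ - q * b′) * g
    multiple-im p q refl = eq p q a′ b′ g
      where
      eq : ∀ p q a b g → p * (g * b) + q * (g * a) - q * (g * b) ≡ (p * b + q * a - q * b) * g
      eq = ℤ-Solver.solve-∀

    -- For every multiple x + yω of g(a′ + b′ω), x - yt is a multiple of gν: multiply x by the
    -- Bézout combination, which is 1, and regroup. Here y = 0.
    multiple-re : ∀ {x} p q → p * (g * a′) - q * (g * b′) ≡ x →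
                  p * (g * b′) + q * (g * a′) - q * (g * b′) ≡ 0ℤ →
                  x ≡ (p * u - q * v - q * u) * (g * ν)
    multiple-re p q refl y≡0 = trans (sym (ℤ.*-identityʳ x))
      (trans (cong (x *_) (sym bézout))
        (trans (eq p q u v a′ b′ g)
          (trans (cong (λ y → y * t + w) y≡0) (rhs t w))))
      where
      x = p * (g * a′) - q * (g * b′)
      w = (p * u - q * v - q * u) * (g * ν)
      eq : ∀ p q u v a b g →
        (p * (g * a) - q * (g * b)) * (u * a + v * b) ≡
        (p * (g * b) + q * (g * a) - q * (g * b)) * ((v + u) * a - u * b)
          + (p * u - q * v - q * u) * (g * (a * a - a * b + b * b))
      eq = ℤ-Solver.solve-∀
      rhs : ∀ t w → 0ℤ * t + w ≡ w
      rhs = ℤ-Solver.solve-∀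

open import Defs
open import Algebra.Properties.CommutativeSemiring.Exp Dᵣ.commutativeSemiring
  using (^-distrib-*; ^-assocʳ)
open import Algebra.Properties.Semiring.Sum Dᵣ.semiring as Sum using (sum)
module Product = CommutativeMonoidSum Dᵣ.*-commutativeMonoid
open Product using () renaming (sum to product)
open IntegerArithmetic

-- The quotient rings of ℤ[ω]

D-ring : AlmostCommutativeRing 0ℓ 0ℓ
D-ring = fromCommutativeRing D-commutativeRing (λ x → dec⇒maybe (0D ≟ x))

injective⇒permutation : ∀ {n} (f : Fin n → Fin n) → Injective _≡_ _≡_ f →
                        Σ[ σ ∈ Permutation′ n ] (∀ i → σ ⟨$⟩ʳ i ≡ f i)
injective⇒permutation {n} f f-inj =
  permutation f f⁻¹ f∘f⁻¹ (λ i → f-inj (f∘f⁻¹ (f i))) , λ _ → refl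
  where
  preimage : ∀ {n} (f : Fin n → Fin n) → Injective _≡_ _≡_ f → ∀ j → ∃[ i ] f i ≡ j
  preimage {suc n} f f-inj j with any? (λ i → f i Fin.≟ j)
  ... | yes found = found
  -- If `j` were missed, punching it out of the codomain would leave an injection of `Fin (suc n)`
  -- into `Fin n`.
  ... | no missed = contradiction (injective⇒≤ punched-injective) ℕ.1+n≰n
    where
    j≢f : ∀ i → j ≢ f i
    j≢f i j≡fi = missed (i , sym j≡fi)
    punched-injective : Injective _≡_ _≡_ (λ i → punchOut (j≢f i))
    punched-injective {i} {k} eq = f-inj (punchOut-injective (j≢f i) (j≢f k) eq)
  f⁻¹ : Fin n → Fin n
  f⁻¹ j = proj₁ (preimage f f-inj j)
  f∘f⁻¹ : ∀ j → f (f⁻¹ j) ≡ j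
  f∘f⁻¹ j = proj₂ (preimage f f-inj j)

module Congruence (π : D) where

  infix 4 _≈_
  -- A record rather than a synonym, so that α and β can be inferred from a proof.
  record _≈_ (α β : D) : Set where
    constructor [_]
    field divisible : α ≡ β [mod π ]
  open _≈_ public

  ≈-refl : ∀ {α} → α ≈ α
  ≈-refl {α} = [ 0D , trans (Dᵣ.zeroˡ π) (sym (Dᵣ.-‿inverseʳ α)) ]

  ≈-reflexive : ∀ {α β} → α ≡ β → α ≈ β
  ≈-reflexive refl = ≈-refl

  ≈-sym : ∀ {α β} → α ≈ β → β ≈ α
  ≈-sym {α} {β} [ κ , p ] = [ - κ , trans (neg κ π) (trans (cong -_ p) (swap α β)) ]
    where
    neg : ∀ κ π → - κ * π ≡ - (κ * π)
    neg = solve-∀ D-ring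
    swap : ∀ α β → - (α - β) ≡ β - α
    swap = solve-∀ D-ring

  ≈-trans : ∀ {α β γ} → α ≈ β → β ≈ γ → α ≈ γ
  ≈-trans {α} {β} {γ} [ κ , p ] [ μ , q ] =
    [ κ + μ , trans (Dᵣ.distribʳ π κ μ) (trans (cong₂ _+_ p q) (eq α β γ)) ]
    where
    eq : ∀ α β γ → (α - β) + (β - γ) ≡ α - γ
    eq = solve-∀ D-ring

  +-cong : ∀ {α β γ δ} → α ≈ β → γ ≈ δ → α + γ ≈ β + δ
  +-cong {α} {β} {γ} {δ} [ κ , p ] [ μ , q ] =
    [ κ + μ , trans (Dᵣ.distribʳ π κ μ) (trans (cong₂ _+_ p q) (eq α β γ δ)) ]
    where
    eq : ∀ α β γ δ → (α - β) + (γ - δ) ≡ (α + γ) - (β + δ)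
    eq = solve-∀ D-ring

  *-cong : ∀ {α β γ δ} → α ≈ β → γ ≈ δ → α * γ ≈ β * δ
  *-cong {α} {β} {γ} {δ} [ κ , p ] [ μ , q ] =
    [ κ * γ + β * μ , trans (eq₁ κ γ β μ π) (trans (cong₂ (λ x y → x * γ + β * y) p q) (eq₂ α β γ δ)) ]
    where
    eq₁ : ∀ κ γ β μ π → (κ * γ + β * μ) * π ≡ κ * π * γ + β * (μ * π)
    eq₁ = solve-∀ D-ring
    eq₂ : ∀ α β γ δ → (α - β) * γ + β * (γ - δ) ≡ α * γ - β * δ
    eq₂ = solve-∀ D-ring

  -‿cong : ∀ {α β} → α ≈ β → - α ≈ - β
  -‿cong {α} {β} [ κ , p ] = [ - κ , trans (neg κ π) (trans (cong -_ p) (swap α β)) ]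
    where
    neg : ∀ κ π → - κ * π ≡ - (κ * π)
    neg = solve-∀ D-ring
    swap : ∀ α β → - (α - β) ≡ - α - - β
    swap = solve-∀ D-ring

  quotientRing : CommutativeRing 0ℓ 0ℓ
  quotientRing = record
    { Carrier = D ; _≈_ = _≈_ ; _+_ = _+_ ; _*_ = _*_ ; -_ = λ α → - α ; 0# = 0D ; 1# = 1D
    ; isCommutativeRing = record
      { isRing = record
        { +-isAbelianGroup = record
          { isGroup = record
            { isMonoid = record
              { isSemigroup = record
                { isMagma = record
                  { isEquivalence = record { refl = ≈-refl ; sym = ≈-sym ; trans = ≈-trans }
                  ; ∙-cong = λ p q → +-cong p q
                  }
                ; assoc = λ α β γ → ≈-reflexive (Dᵣ.+-assoc α β γ)
                }
              ; identity = (λ α → ≈-reflexive (Dᵣ.+-identityˡ α))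
                         , (λ α → ≈-reflexive (Dᵣ.+-identityʳ α))
              }
            ; inverse = (λ α → ≈-reflexive (Dᵣ.-‿inverseˡ α))
                      , (λ α → ≈-reflexive (Dᵣ.-‿inverseʳ α))
            ; ⁻¹-cong = λ p → -‿cong p
            }
          ; comm = λ α β → ≈-reflexive (Dᵣ.+-comm α β)
          }
        ; *-cong = λ p q → *-cong p q
        ; *-assoc = λ α β γ → ≈-reflexive (Dᵣ.*-assoc α β γ)
        ; *-identity = (λ α → ≈-reflexive (Dᵣ.*-identityˡ α))
                     , (λ α → ≈-reflexive (Dᵣ.*-identityʳ α))
        ; distrib = (λ α β γ → ≈-reflexive (Dᵣ.distribˡ α β γ))
                  , (λ α β γ → ≈-reflexive (Dᵣ.distribʳ α β γ))
        }
      ; *-comm = λ α β → ≈-reflexive (Dᵣ.*-comm α β)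
      }
    }

  private
    x-0≡x : ∀ α → α - 0D ≡ α
    x-0≡x = solve-∀ D-ring

  ≈0⇒∣ : ∀ {α} → α ≈ 0D → π ∣ α
  ≈0⇒∣ {α} [ κ , p ] = κ , trans p (x-0≡x α)

  ∣⇒≈0 : ∀ {α} → π ∣ α → α ≈ 0D
  ∣⇒≈0 {α} (κ , p) = [ κ , trans p (sym (x-0≡x α)) ]

-- Complete residue systems

-- Residue classes are handled through representatives, so that sums over K become finite sums over
-- `Fin n` of values in D.
record ResidueSystem (π : D) (n : ℕ) : Set where
  open Congruence π
  field
    rep           : Fin n → D
    index         : D → Fin n
    rep-index     : ∀ α → rep (index α) ≈ α
    rep-injective : ∀ {i j} → rep i ≈ rep j → i ≡ j


-- The triangular basis of `Reduction` makes the box 0 ≤ x < gν, 0 ≤ y < g a set of representatives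
-- x + yω; it has g · gν = N π points.
residueSystem : ∀ π → π ≢ 0D → ResidueSystem π ∣ N π ∣
residueSystem π@(a +ω· b) π≢0
  with primitivePart a b (λ where (refl , refl) → π≢0 refl)
... | record { g = g ; a′ = a′ ; b′ = b′ ; u = u ; v = v ; a≡ = refl ; b≡ = refl ; bézout = bézout } =
  subst (ResidueSystem π) size record
    { rep = rep ; index = index ; rep-index = rep-index ; rep-injective = rep-injective }
  where
  open Congruence π
  open Reduction {+ g} {a′} {b′} {u} {v} bézout
  n₁ = ∣ ν ∣
  ν≡ : + n₁ ≡ ν
  ν≡ = sym (N-nonneg (a′ +ω· b′))
  size : g ℕ.* (g ℕ.* n₁) ≡ ∣ N π ∣
  size = ℤ.+-injective (trans (ℤ.pos-* g (g ℕ.* n₁)) (trans (cong (+ g ℤ.*_) (ℤ.pos-* g n₁))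
    (trans (cong (λ z → + g ℤ.* (+ g ℤ.* z)) ν≡) (trans (eq (+ g) a′ b′) (N-nonneg π)))))
    where
    eq : ∀ g a b → g ℤ.* (g ℤ.* (a ℤ.* a ℤ.- a ℤ.* b ℤ.+ b ℤ.* b)) ≡
         g ℤ.* a ℤ.* (g ℤ.* a) ℤ.- g ℤ.* a ℤ.* (g ℤ.* b) ℤ.+ g ℤ.* b ℤ.* (g ℤ.* b)
    eq = ℤ-Solver.solve-∀
  instance
    size≢0 : ℕ.NonZero (g ℕ.* (g ℕ.* n₁))
    size≢0 = ℕ.≢-nonZero λ p → π≢0 (N≡0⇒≡0 π (ℤ.∣i∣≡0⇒i≡0 (trans (sym size) p)))
    g≢0 : ℕ.NonZero g
    g≢0 = ℕ.m*n≢0⇒m≢0 g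
    gν≢0 : ℕ.NonZero (g ℕ.* n₁)
    gν≢0 = ℕ.m*n≢0⇒n≢0 g
  pair : Fin g × Fin (g ℕ.* n₁) → D
  pair (j , i) = + toℕ i +ω· + toℕ j
  rep : Fin (g ℕ.* (g ℕ.* n₁)) → D
  rep k = pair (remQuot (g ℕ.* n₁) k)
  -- The real coordinate that remains once the multiple of g(t + ω) which reduces y modulo g has
  -- been subtracted.
  shifted : D → ℤ
  shifted (x +ω· y) = x ℤ.+ ℤ.- (y ℤ./ℕ g ℤ.* + g ℤ.* t)
  indices : D → Fin g × Fin (g ℕ.* n₁)
  indices α = fromℕ< (ℤ.n%ℕd<d (im α) g) , fromℕ< (ℤ.n%ℕd<d (shifted α) (g ℕ.* n₁))
  index : D → Fin (g ℕ.* (g ℕ.* n₁))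
  index α = uncurry combine (indices α)
  gν≡ : + (g ℕ.* n₁) ≡ + g ℤ.* ν
  gν≡ = trans (ℤ.pos-* g n₁) (cong (+ g ℤ.*_) ν≡)
  rep-index : ∀ α → rep (index α) ≈ α
  rep-index α@(x +ω· y) = ≈-trans
    (≈-reflexive (trans
      (cong pair (remQuot-combine (proj₁ (indices α)) (proj₂ (indices α))))
      (cong₂ (λ i j → + i +ω· + j) (toℕ-fromℕ< (ℤ.n%ℕd<d (shifted α) (g ℕ.* n₁)))
                                   (toℕ-fromℕ< (ℤ.n%ℕd<d y g)))))
    [ (ℤ.- (k ℤ.* (v ℤ.+ u) ℤ.+ l ℤ.* (a′ ℤ.- b′)) +ω· ℤ.- (k ℤ.* u ℤ.+ l ℤ.* ℤ.- b′))
    , cong₂ _+ω·_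
        (reduce-re x (+ (shifted α ℤ.%ℕ (g ℕ.* n₁))) k l (trans (ℤ.a≡a%ℕn+[a/ℕn]*n (shifted α) (g ℕ.* n₁))
          (cong (λ z → + (shifted α ℤ.%ℕ (g ℕ.* n₁)) ℤ.+ l ℤ.* z) gν≡)))
        (reduce-im y (+ (y ℤ.%ℕ g)) k l (ℤ.a≡a%ℕn+[a/ℕn]*n y g)) ]
    where
    k = y ℤ./ℕ g
    l = shifted α ℤ./ℕ (g ℕ.* n₁)
  pair-injective : ∀ p q → pair p ≈ pair q → p ≡ q
  pair-injective (j , i) (j′ , i′) [ (p +ω· q) , eq ] = cong₂ _,_ j≡j′ i≡i′
    where
    j≡j′ : j ≡ j′
    j≡j′ = toℕ-injective (<∧∣-⇒≡ (p ℤ.* b′ ℤ.+ q ℤ.* a′ ℤ.- q ℤ.* b′) (toℕ<n j) (toℕ<n j′)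
      (multiple-im p q (cong im eq)))
    i≡i′ : i ≡ i′
    i≡i′ = toℕ-injective (<∧∣-⇒≡ (p ℤ.* u ℤ.- q ℤ.* v ℤ.- q ℤ.* u) (toℕ<n i) (toℕ<n i′)
      (trans (multiple-re p q (cong re eq)
               (trans (cong im eq) (ℤ.i≡j⇒i-j≡0 (cong (λ k → + toℕ k) j≡j′))))
             (cong ((p ℤ.* u ℤ.- q ℤ.* v ℤ.- q ℤ.* u) ℤ.*_) (sym gν≡))))
  rep-injective : ∀ {i j} → rep i ≈ rep j → i ≡ j
  rep-injective {i} {j} p = trans (sym (combine-remQuot {g} (g ℕ.* n₁) i))
    (trans (cong (uncurry combine) (pair-injective (remQuot (g ℕ.* n₁) i) (remQuot (g ℕ.* n₁) j) p))
           (combine-remQuot {g} (g ℕ.* n₁) j))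

-- Sums over residues

fromℕ : ℕ → D
fromℕ n = fromℤ (+ n)

fromℕ-suc : ∀ n α → α + fromℕ n * α ≡ fromℕ (suc n) * α
fromℕ-suc n α = eq (fromℕ n) α
  where
  eq : ∀ m α → α + m * α ≡ (1D + m) * α
  eq = solve-∀ D-ring

sum-constant : ∀ n α → sum {n} (λ _ → α) ≡ fromℕ n * α
sum-constant zero    α = sym (Dᵣ.zeroˡ α)
sum-constant (suc n) α = trans (cong (λ z → α + z) (sum-constant n α)) (fromℕ-suc n α)

fromℕ-* : ∀ m n → fromℕ m * fromℕ n ≡ fromℕ (m ℕ.* n)
fromℕ-* m n = trans (sym (sum-constant m (fromℕ n))) (multiple m)
  where
  multiple : ∀ m → sum {m} (λ _ → fromℕ n) ≡ fromℕ (m ℕ.* n)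
  multiple zero    = refl
  multiple (suc m) = cong (λ z → fromℕ n + z) (multiple m)

module Residues {π : D} {n : ℕ} (system : ResidueSystem π (suc n)) where
  open ResidueSystem system
  open Congruence π

  ∑ : (D → D) → D
  ∑ f = sum (λ i → f (rep i))

  -- An injection of a finite set into itself permutes it. The monoid is left open to serve sums in
  -- D as well as sums and products in the quotient ring.
  reindex : (M : CommutativeMonoid 0ℓ 0ℓ) →
            let open CommutativeMonoid M using (Carrier) renaming (_≈_ to _≈ᴹ_)
                open CommutativeMonoidSum M using () renaming (sum to sumᴹ) in
            (f : D → Carrier) → (∀ {α β} → α ≈ β → f α ≈ᴹ f β) →
            (σ : D → D) → (∀ {α β} → σ α ≈ σ β → α ≈ β) →
            sumᴹ (λ i → f (rep i)) ≈ᴹ sumᴹ (λ i → f (σ (rep i)))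
  reindex M f f-cong σ σ-injective = CommutativeMonoid.trans M
    (CommutativeMonoidSum.sum-permute M (λ i → f (rep i)) (proj₁ perm))
    (CommutativeMonoidSum.sum-cong-≋ M λ i → f-cong
      (≈-trans (≈-reflexive (cong rep (proj₂ perm i))) (rep-index (σ (rep i)))))
    where
    perm = injective⇒permutation (λ i → index (σ (rep i))) λ {i} {j} eq → rep-injective
      (σ-injective (≈-trans (≈-sym (rep-index (σ (rep i))))
        (≈-trans (≈-reflexive (cong rep eq)) (rep-index (σ (rep j))))))

  ∑-reindex : (f : D → D) → (∀ {α β} → α ≈ β → f α ≡ f β) →
              (σ : D → D) → (∀ {α β} → σ α ≈ σ β → α ≈ β) →
              ∑ f ≡ ∑ (λ α → f (σ α))
  ∑-reindex = reindex Dᵣ.+-commutativeMonoid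

  ∑-cong : ∀ {f g : D → D} → (∀ α → f α ≡ g α) → ∑ f ≡ ∑ g
  ∑-cong f≗g = Sum.sum-cong-≗ (λ i → f≗g (rep i))

  ∑-cong-≈ : ∀ {f g : D → D} → (∀ α → f α ≈ g α) → ∑ f ≈ ∑ g
  ∑-cong-≈ f≗g = CommutativeMonoidSum.sum-cong-≋
    (CommutativeRing.+-commutativeMonoid quotientRing) (λ i → f≗g (rep i))

  ∑-+ : ∀ (f g : D → D) → ∑ (λ α → f α + g α) ≡ ∑ f + ∑ g
  ∑-+ f g = Sum.∑-distrib-+ (λ i → f (rep i)) (λ i → g (rep i))

  ∑-* : ∀ c (f : D → D) → c * ∑ f ≡ ∑ (λ α → c * f α)
  ∑-* c f = Sum.*-distribˡ-sum c (λ i → f (rep i))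

  ∑-comm : ∀ (f : D → D → D) → ∑ (λ α → ∑ (f α)) ≡ ∑ (λ β → ∑ (λ α → f α β))
  ∑-comm f = Sum.∑-comm (λ i j → f (rep i) (rep j))

  ∑-constant : ∀ α → ∑ (λ _ → α) ≡ fromℕ (suc n) * α
  ∑-constant α = sum-constant (suc n) α

  rep-punchIn≉ : ∀ α i → ¬ rep (punchIn (index α) i) ≈ α
  rep-punchIn≉ α i p = punchInᵢ≢i (index α) i
    (rep-injective (≈-trans p (≈-sym (rep-index α))))

  ∑-point : ∀ (f : D → D) → (∀ {α β} → α ≈ β → f α ≡ f β) →
            ∀ β → (∀ {α} → ¬ α ≈ β → f α ≡ 0D) → ∑ f ≡ f β
  ∑-point f f-cong β f-zero = begin
    ∑ f                             ≡⟨ Sum.sum-remove {n} {index β} (λ i → f (rep i)) ⟩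
    f (rep (index β)) + sum {n} _   ≡⟨ cong₂ _+_ (f-cong (rep-index β)) (Sum.sum-cong-≗
                                         (λ i → f-zero (rep-punchIn≉ β i))) ⟩
    f β + sum {n} (λ _ → 0D)        ≡⟨ cong (λ z → f β + z) (Sum.sum-replicate-zero n) ⟩
    f β + 0D                        ≡⟨ Dᵣ.+-identityʳ (f β) ⟩
    f β                             ∎
    where open ≡-Reasoning

  ∑-split : ∀ (f : D → D) {a b} → (∀ {α} → α ≈ 0D → f α ≡ a) → (∀ {α} → ¬ α ≈ 0D → f α ≡ b) →
            ∑ f ≡ a + fromℕ n * b
  ∑-split f {a} {b} f-zero f-nonzero = trans
    (Sum.sum-remove {n} {index 0D} (λ i → f (rep i)))
    (cong₂ _+_ (f-zero (rep-index 0D)) (trans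
      (Sum.sum-cong-≗ (λ i → f-nonzero (rep-punchIn≉ 0D i)))
      (sum-constant n b)))

-- Polynomials over a residue field

-- cs lists the coefficients below the leading one, constant term first.
eval : ∀ {d} → Vec D d → D → D
eval []       x = 1D
eval (c ∷ cs) x = c + x * eval cs x

-- Synthetic division by X - r: the coefficients of the quotient are the values at r of the tails,
-- as in Horner's scheme.
divideBy : ∀ {d} → D → Vec D (suc d) → Vec D d
divideBy r (c ∷ [])         = []
divideBy r (c ∷ cs@(_ ∷ _)) = eval cs r ∷ divideBy r cs

eval-divideBy : ∀ {d} r (cs : Vec D (suc d)) x →
                eval cs x ≡ (x - r) * eval (divideBy r cs) x + eval cs r
eval-divideBy r (c ∷ [])         x = eq c r x
  where
  eq : ∀ c r x → c + x * 1D ≡ (x - r) * 1D + (c + r * 1D)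
  eq = solve-∀ D-ring
eval-divideBy r (c ∷ cs@(_ ∷ _)) x =
  trans (cong (λ z → c + x * z) (eval-divideBy r cs x)) (eq c r x (eval (divideBy r cs) x) (eval cs r))
  where
  eq : ∀ c r x q e → c + x * ((x - r) * q + e) ≡ (x - r) * (e + x * q) + (c + r * e)
  eq = solve-∀ D-ring

count : ∀ {m} → (Fin m → Bool) → ℕ
count {zero}  s = 0
count {suc m} s = if s zero then suc (count (s ∘ suc)) else count (s ∘ suc)

module PrimeModulus {π : D} (π-prime : Prime π) where
  open Congruence π
  open Prime π-prime using (p∤1; split-∣) renaming (p≉0 to π≢0)
  private module K = CommutativeRing quotientRing

  ≈0? : ∀ α → Dec (α ≈ 0D)
  ≈0? α = map′ ∣⇒≈0 ≈0⇒∣ (π ∣? α)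

  1≉0 : ¬ 1D ≈ 0D
  1≉0 p = p∤1 (≈0⇒∣ p)

  *≈0⇒ : ∀ α β → α * β ≈ 0D → α ≈ 0D ⊎ β ≈ 0D
  *≈0⇒ α β p = ⊎.map ∣⇒≈0 ∣⇒≈0 (split-∣ {α} {β} (≈0⇒∣ p))

  *≉0 : ∀ {α β} → ¬ α ≈ 0D → ¬ β ≈ 0D → ¬ α * β ≈ 0D
  *≉0 {α} {β} α≉0 β≉0 p = ⊎.[ α≉0 , β≉0 ]′ (*≈0⇒ α β p)

  *-cancelˡ-≈0 : ∀ {α β} → ¬ α ≈ 0D → α * β ≈ 0D → β ≈ 0D
  *-cancelˡ-≈0 {α} {β} α≉0 p = ⊎.fromInj₂ (λ α≈0 → contradiction α≈0 α≉0) (*≈0⇒ α β p)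

  -≈0⇒≈ : ∀ {α β} → α - β ≈ 0D → α ≈ β
  -≈0⇒≈ p = [ ≈0⇒∣ p ]

  ≈⇒-≈0 : ∀ {α β} → α ≈ β → α - β ≈ 0D
  ≈⇒-≈0 [ d ] = ∣⇒≈0 d

  *-cancelˡ : ∀ {γ α β} → ¬ γ ≈ 0D → γ * α ≈ γ * β → α ≈ β
  *-cancelˡ {γ} {α} {β} γ≉0 p = -≈0⇒≈ (*-cancelˡ-≈0 {γ} {α - β} γ≉0
    (≈-trans (≈-reflexive (eq γ α β)) (≈⇒-≈0 p)))
    where
    eq : ∀ γ α β → γ * (α - β) ≡ γ * α - γ * β
    eq = solve-∀ D-ring

  product-cong : ∀ {m} {f g : Fin m → D} → (∀ i → f i ≈ g i) → product f ≈ product g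
  product-cong = CommutativeMonoidSum.sum-cong-≋ K.*-commutativeMonoid

  product≉0 : ∀ {m} (f : Fin m → D) → (∀ i → ¬ f i ≈ 0D) → ¬ product f ≈ 0D
  product≉0 {zero}  f f≉0 = 1≉0
  product≉0 {suc m} f f≉0 = *≉0 (f≉0 zero) (product≉0 (f ∘ suc) (f≉0 ∘ suc))

  module _ {d : ℕ} (cs : Vec D (suc d)) (r : D) (root : eval cs r ≈ 0D) where

    factor : ∀ x → eval cs x ≈ (x - r) * eval (divideBy r cs) x
    factor x = ≈-trans (≈-reflexive (eval-divideBy r cs x))
      (≈-trans (+-cong (≈-refl {(x - r) * eval (divideBy r cs) x}) root) (≈-reflexive (Dᵣ.+-identityʳ ((x - r) * eval (divideBy r cs) x))))

    other-root : ∀ x → ¬ x ≈ r → eval cs x ≈ 0D → eval (divideBy r cs) x ≈ 0D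
    other-root x x≉r p = *-cancelˡ-≈0 {x - r} (λ q → x≉r (-≈0⇒≈ q)) (≈-trans (≈-sym (factor x)) p)

  roots≤degree : ∀ {m d} (r : Fin m → D) → (∀ {i j} → r i ≈ r j → i ≡ j) →
                 (cs : Vec D d) → (∀ i → eval cs (r i) ≈ 0D) → m ℕ.≤ d
  roots≤degree {zero}          r distinct cs roots = ℕ.z≤n
  roots≤degree {suc m} {zero}  r distinct [] roots = contradiction (roots zero) 1≉0
  roots≤degree {suc m} {suc d} r distinct cs roots = ℕ.s≤s
    (roots≤degree (r ∘ suc) (λ p → suc-injective (distinct p)) (divideBy (r zero) cs)
      (λ i → other-root cs (r zero) (roots zero) (r (suc i))
        (λ p → contradiction (distinct p) λ ()) (roots (suc i))))

  -- Each selected root splits off a linear factor and stays apart from the others; when none is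
  -- left the degree is 0 and the monic quotient is 1. A mask `s` on a larger family selects the
  -- roots, so that the kernel of the character needs no enumeration of its own.
  roots-product : ∀ {m d} (r : Fin m → D) → (∀ {i j} → r i ≈ r j → i ≡ j) →
                  (s : Fin m → Bool) → count s ≡ d →
                  (cs : Vec D d) → (∀ i → s i ≡ true → eval cs (r i) ≈ 0D) →
                  ∀ x → eval cs x ≈ product (λ i → if s i then x - r i else 1D)
  roots-product {zero}  {zero}  r distinct s eq [] roots x = ≈-refl
  roots-product {suc m}         r distinct s eq cs roots x with s zero in s₀
  roots-product {suc m}         r distinct s eq cs roots x | false =
    ≈-trans (roots-product (r ∘ suc) (λ p → suc-injective (distinct p)) (s ∘ suc) eq cs (roots ∘ suc) x)
            (≈-reflexive (sym (Dᵣ.*-identityˡ _)))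
  roots-product {suc m} {suc d} r distinct s eq cs roots x | true =
    ≈-trans (factor cs (r zero) (roots zero s₀) x) (*-cong (≈-refl {x - r zero})
      (roots-product (r ∘ suc) (λ p → suc-injective (distinct p)) (s ∘ suc) (ℕ.suc-injective eq)
        (divideBy (r zero) cs)
        (λ i sᵢ → other-root cs (r zero) (roots zero s₀) (r (suc i))
          (λ p → contradiction (distinct p) λ ()) (roots (suc i) sᵢ)) x))

-- Power sums

eval-replicate-0 : ∀ d x → eval (replicate d 0D) x ≡ x ^ d
eval-replicate-0 zero    x = refl
eval-replicate-0 (suc d) x =
  trans (Dᵣ.+-identityˡ (x * eval (replicate d 0D) x)) (cong (x *_) (eval-replicate-0 d x))

module FiniteField {π : D} {n : ℕ} (π-prime : Prime π) (system : ResidueSystem π (suc n)) where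
  open Congruence π
  open PrimeModulus π-prime
  open ResidueSystem system
  open Residues system
  private module K = CommutativeRing quotientRing

  ifZero : ∀ {A : Set} → D → A → A → A
  ifZero α a b = if does (≈0? α) then a else b

  ifZero-yes : ∀ {A : Set} {α} {a b : A} → α ≈ 0D → ifZero α a b ≡ a
  ifZero-yes {α = α} {a} {b} p = cong (λ z → if z then a else b) (dec-true (≈0? α) p)

  ifZero-no : ∀ {A : Set} {α} {a b : A} → ¬ α ≈ 0D → ifZero α a b ≡ b
  ifZero-no {α = α} {a} {b} p = cong (λ z → if z then a else b) (dec-false (≈0? α) p)

  byZero : ∀ {P : Set} α → (α ≈ 0D → P) → (¬ α ≈ 0D → P) → P
  byZero {P} α f g = go (≈0? α)
    where
    go : Dec (α ≈ 0D) → P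
    go (yes p) = f p
    go (no p)  = g p

  ^-cong : ∀ {α β} k → α ≈ β → α ^ k ≈ β ^ k
  ^-cong zero    p = ≈-refl
  ^-cong (suc k) p = *-cong p (^-cong k p)

  scaling-injective : ∀ {γ} → ¬ γ ≈ 0D → ∀ {α β} → γ * α ≈ γ * β → α ≈ β
  scaling-injective γ≉0 = *-cancelˡ γ≉0

  -- Multiplication by α permutes the residues and multiplies the product P of the nonzero ones by
  -- α^n. In `unit` the residue 0 counts as 1, and in `scale` it receives no factor α, so that both
  -- products run over all residues.
  fermat : ∀ {α} → ¬ α ≈ 0D → α ^ n ≈ 1D
  fermat {α} α≉0 = *-cancelˡ {P} {α ^ n} {1D} (product≉0 (λ i → unit (rep i)) (λ i → unit≉0 (rep i)))
    (≈-trans (≈-reflexive (trans (Dᵣ.*-comm P (α ^ n)) (cong (_* P) (sym product-scale))))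
      (≈-trans (≈-reflexive (sym (Product.∑-distrib-+ (λ i → scale (rep i)) (λ i → unit (rep i)))))
        (≈-trans (≈-sym (product-cong (λ i → unit-scale (rep i))))
          (≈-trans (≈-sym (reindex K.*-commutativeMonoid unit (λ {x} {y} → unit-cong x y)
                             (α *_) (scaling-injective α≉0)))
            (≈-reflexive (sym (Dᵣ.*-identityʳ P)))))))
    where
    unit scale : D → D
    unit x  = ifZero x 1D x
    scale x = ifZero x 1D α
    P = product (λ i → unit (rep i))
    unit-cong : ∀ x y → x ≈ y → unit x ≈ unit y
    unit-cong x y x≈y = byZero x
      (λ x≈0 → ≈-reflexive (trans (ifZero-yes x≈0) (sym (ifZero-yes (≈-trans (≈-sym x≈y) x≈0)))))
      (λ x≉0 → ≈-trans (≈-reflexive (ifZero-no x≉0))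
        (≈-trans x≈y (≈-reflexive (sym (ifZero-no (λ y≈0 → x≉0 (≈-trans x≈y y≈0)))))))
    unit≉0 : ∀ x → ¬ unit x ≈ 0D
    unit≉0 x p = byZero x
      (λ x≈0 → 1≉0 (≈-trans (≈-reflexive (sym (ifZero-yes x≈0))) p))
      (λ x≉0 → x≉0 (≈-trans (≈-reflexive (sym (ifZero-no x≉0))) p))
    unit-scale : ∀ x → unit (α * x) ≈ scale x * unit x
    unit-scale x = byZero x
      (λ x≈0 → ≈-reflexive (trans
        (ifZero-yes (≈-trans (*-cong (≈-refl {α}) x≈0) (≈-reflexive (Dᵣ.zeroʳ α))))
        (sym (cong₂ _*_ (ifZero-yes {a = 1D} x≈0) (ifZero-yes {a = 1D} {b = x} x≈0)))))
      (λ x≉0 → ≈-reflexive (trans (ifZero-no (*≉0 α≉0 x≉0))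
        (sym (cong₂ _*_ (ifZero-no {a = 1D} x≉0) (ifZero-no {a = 1D} {b = x} x≉0)))))
    product-scale : product (λ i → scale (rep i)) ≡ α ^ n
    product-scale = begin
      product (λ i → scale (rep i))
        ≡⟨ Product.sum-remove {n} {index 0D} (λ i → scale (rep i)) ⟩
      scale (rep (index 0D)) * product {n} _
        ≡⟨ cong₂ _*_ (ifZero-yes {a = 1D} (rep-index 0D))
             (Product.sum-cong-≗ (λ i → ifZero-no {a = 1D} (rep-punchIn≉ 0D i))) ⟩
      1D * product {n} (λ _ → α)
        ≡⟨ Dᵣ.*-identityˡ (product {n} (λ _ → α)) ⟩
      product {n} (λ _ → α)
        ≡⟨ Product.sum-replicate n ⟩
      α ^ n ∎
      where open ≡-Reasoning

  -- Otherwise X^(k+1) - X would vanish at all n + 1 residues, although its degree k + 1 is at most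
  -- n.
  power-nontrivial : ∀ k → 1 ℕ.≤ k → k ℕ.< n → ¬ (∀ α → ¬ α ≈ 0D → α ^ k ≈ 1D)
  power-nontrivial (suc k) _ k<n trivial =
    ℕ.<⇒≱ k<n (ℕ.s≤s⁻¹ (roots≤degree rep rep-injective (0D ∷ (- 1D) ∷ replicate k 0D) (λ i → roots (rep i))))
    where
    eq : ∀ x y → 0D + x * (- 1D + x * y) ≡ x * (x * y - 1D)
    eq = solve-∀ D-ring
    zero* : ∀ x {y} → x ≈ 0D → x * y ≈ 0D
    zero* x {y} p = ≈-trans (*-cong p (≈-refl {y})) (≈-reflexive (Dᵣ.zeroˡ y))
    *zero : ∀ x {y} → y ≈ 0D → x * y ≈ 0D
    *zero x {y} p = ≈-trans (*-cong (≈-refl {x}) p) (≈-reflexive (Dᵣ.zeroʳ x))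
    roots : ∀ x → eval (0D ∷ (- 1D) ∷ replicate k 0D) x ≈ 0D
    roots x = ≈-trans
      (≈-reflexive (trans (cong (λ z → 0D + x * (- 1D + x * z)) (eval-replicate-0 k x)) (eq x (x ^ k))))
      (byZero x (zero* x) (λ x≉0 → *zero x (≈⇒-≈0 (trivial x x≉0))))

  -- Scaling by γ multiplies the sum S by γ^k. If S were not 0, cancelling it would give γ^k ≡ 1 for
  -- all nonzero γ. No particular γ is exhibited, hence the argument by decidability.
  ∑-power : ∀ k → 1 ℕ.≤ k → k ℕ.< n → ∑ (_^ k) ≈ 0D
  ∑-power k 1≤k k<n = decidable-stable (≈0? S) λ S≉0 →
    power-nontrivial k 1≤k k<n λ γ γ≉0 → *-cancelˡ {S} {γ ^ k} {1D} S≉0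
      (≈-trans (≈-reflexive (trans (Dᵣ.*-comm S (γ ^ k))
          (trans (∑-* (γ ^ k) (_^ k)) (∑-cong (λ α → sym (^-distrib-* γ α k))))))
        (≈-trans (≈-sym (reindex K.+-commutativeMonoid (_^ k) (^-cong k) (γ *_) (scaling-injective γ≉0)))
          (≈-reflexive (sym (Dᵣ.*-identityʳ S)))))
    where S = ∑ (_^ k)

  -- Instead of a binomial expansion, one factor 1 - α at a time is multiplied out. Both resulting
  -- sums keep j ≥ 1 and total exponent below n.
  ∑-power-product : ∀ j k → 1 ℕ.≤ j → j ℕ.+ k ℕ.< n → ∑ (λ α → α ^ j * (1D - α) ^ k) ≈ 0D
  ∑-power-product j zero    1≤j j+k<n = ≈-trans
    (≈-reflexive (∑-cong (λ α → Dᵣ.*-identityʳ (α ^ j))))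
    (∑-power j 1≤j (subst (ℕ._< n) (ℕ.+-identityʳ j) j+k<n))
  ∑-power-product j (suc k) 1≤j j+k<n = ≈-trans
    (≈-reflexive (trans (∑-cong (λ α → eq α (α ^ j) ((1D - α) ^ k)))
      (trans (∑-+ (λ α → α ^ j * (1D - α) ^ k) (λ α → - 1D * (α ^ suc j * (1D - α) ^ k)))
        (cong (λ z → S₁ + z) (sym (∑-* (- 1D) (λ α → α ^ suc j * (1D - α) ^ k)))))))
    (+-cong (∑-power-product j k 1≤j (ℕ.<-trans (ℕ.+-monoʳ-< j (ℕ.n<1+n k)) j+k<n))
      (*-cong (≈-refl { - 1D}) (∑-power-product (suc j) k (ℕ.s≤s ℕ.z≤n)
        (subst (ℕ._< n) (ℕ.+-suc j k) j+k<n))))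
    where
    S₁ = ∑ (λ α → α ^ j * (1D - α) ^ k)
    eq : ∀ a x y → x * ((1D - a) * y) ≡ x * y + - 1D * (a * x * y)
    eq = solve-∀ D-ring

-- Cubic characters and the norm of the Jacobi sum

D-*≡0⇒ : ∀ α β → α * β ≡ 0D → α ≡ 0D ⊎ β ≡ 0D
D-*≡0⇒ α β p = ⊎.map (N≡0⇒≡0 α) (N≡0⇒≡0 β)
  (ℤ.i*j≡0⇒i≡0∨j≡0 (N α) (trans (sym (N-* α β)) (cong N p)))

D-*-cancelˡ : ∀ γ α β → γ ≢ 0D → γ * α ≡ γ * β → α ≡ β
D-*-cancelˡ γ α β γ≢0 p =
  ⊎.[ (λ γ≡0 → contradiction γ≡0 γ≢0) , (λ q → trans (sym (eq₂ α β)) (trans (cong (λ z → z + β) q) (Dᵣ.+-identityˡ β))) ]′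
  (D-*≡0⇒ γ (α - β) (trans (eq₁ γ α β) (trans (cong (λ z → z - γ * β) p) (Dᵣ.-‿inverseʳ (γ * β)))))
  where
  eq₁ : ∀ γ α β → γ * (α - β) ≡ γ * α - γ * β
  eq₁ = solve-∀ D-ring
  eq₂ : ∀ α β → (α - β) + β ≡ α
  eq₂ = solve-∀ D-ring

square≡1 : ∀ {γ} → CubeRootOfUnity γ → γ * γ ≡ 1D → γ ≡ 1D
square≡1 (inj₁ refl)        _ = refl
square≡1 (inj₂ (inj₁ refl)) ()
square≡1 (inj₂ (inj₂ refl)) ()

idempotent≡1 : ∀ {γ} → CubeRootOfUnity γ → γ * γ ≡ γ → γ ≡ 1D
idempotent≡1 (inj₁ refl)        _ = refl
idempotent≡1 (inj₂ (inj₁ refl)) ()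
idempotent≡1 (inj₂ (inj₂ refl)) ()

cube≡1 : ∀ {γ} → CubeRootOfUnity γ → γ * (γ * γ) ≡ 1D
cube≡1 (inj₁ refl)        = refl
cube≡1 (inj₂ (inj₁ refl)) = refl
cube≡1 (inj₂ (inj₂ refl)) = refl

-- The values are numbers in D rather than residues modulo π, since sums of them are to be compared
-- in D itself and modulo 9.
record IsCubicCharacter (π : D) (e : D → D) : Set where
  open Congruence π
  field
    e-cong       : ∀ {α β} → α ≈ β → e α ≡ e β
    e-*          : ∀ α β → e (α * β) ≡ e α * e β
    e-zero       : ∀ {α} → α ≈ 0D → e α ≡ 0D
    e-root       : ∀ {α} → ¬ α ≈ 0D → CubeRootOfUnity (e α)
    e-nontrivial : ¬ (∀ α → ¬ α ≈ 0D → e α ≡ 1D)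

module CharacterSums {π : D} {n : ℕ} (π-prime : Prime π) (system : ResidueSystem π (suc n)) (n≢0 : n ≢ 0)
                     (e : D → D) (isCubicCharacter : IsCubicCharacter π e) where
  open Congruence π
  open PrimeModulus π-prime
  open ResidueSystem system
  open Residues system
  open FiniteField π-prime system
  open IsCubicCharacter isCubicCharacter

  -- The square of a cubic character is its inverse on nonzero residues and also its complex
  -- conjugate (`conj-e`).
  ē : D → D
  ē α = e α * e α

  ē-cong : ∀ {α β} → α ≈ β → ē α ≡ ē β
  ē-cong p = cong₂ _*_ (e-cong p) (e-cong p)

  ē-* : ∀ α β → ē (α * β) ≡ ē α * ē β
  ē-* α β = trans (cong₂ _*_ (e-* α β) (e-* α β)) (eq (e α) (e β))
    where
    eq : ∀ x y → x * y * (x * y) ≡ x * x * (y * y)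
    eq = solve-∀ D-ring

  ē-zero : ∀ {α} → α ≈ 0D → ē α ≡ 0D
  ē-zero p = cong₂ _*_ (e-zero p) (e-zero p)

  e*ē : ∀ {α} → ¬ α ≈ 0D → e α * ē α ≡ 1D
  e*ē α≉0 = cube≡1 (e-root α≉0)

  e-1 : e 1D ≡ 1D
  e-1 = idempotent≡1 (e-root 1≉0) (sym (e-* 1D 1D))

  -1≉0 : ¬ - 1D ≈ 0D
  -1≉0 p = 1≉0 (-‿cong p)

  e--1 : e (- 1D) ≡ 1D
  e--1 = square≡1 (e-root -1≉0) (trans (sym (e-* (- 1D) (- 1D))) e-1)

  e-neg : ∀ α → e (- α) ≡ e α
  e-neg α = trans (cong e (eq α)) (trans (e-* (- 1D) α) (trans (cong (_* e α) e--1) (Dᵣ.*-identityˡ (e α))))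
    where
    eq : ∀ α → - α ≡ - 1D * α
    eq = solve-∀ D-ring

  ∑-multiplicative : (h : D → D) → (∀ {α β} → α ≈ β → h α ≡ h β) → (∀ α β → h (α * β) ≡ h α * h β) →
                     ¬ (∀ α → ¬ α ≈ 0D → h α ≡ 1D) → ∑ h ≡ 0D
  ∑-multiplicative h h-cong h-* nontrivial = decidable-stable (∑ h ≟ 0D) λ ∑h≢0 →
    nontrivial λ γ γ≉0 → D-*-cancelˡ (∑ h) (h γ) 1D ∑h≢0 (begin
      ∑ h * h γ             ≡⟨ Dᵣ.*-comm (∑ h) (h γ) ⟩
      h γ * ∑ h             ≡⟨ ∑-* (h γ) h ⟩
      ∑ (λ α → h γ * h α)   ≡⟨ ∑-cong (λ α → h-* γ α) ⟨
      ∑ (λ α → h (γ * α))   ≡⟨ ∑-reindex h h-cong (γ *_) (scaling-injective γ≉0) ⟨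
      ∑ h                   ≡⟨ Dᵣ.*-identityʳ (∑ h) ⟨
      ∑ h * 1D              ∎)
    where open ≡-Reasoning

  ∑e : ∑ e ≡ 0D
  ∑e = ∑-multiplicative e e-cong e-* e-nontrivial

  ∑ē : ∑ ē ≡ 0D
  ∑ē = ∑-multiplicative ē ē-cong ē-* λ trivial →
    e-nontrivial λ α α≉0 → square≡1 (e-root α≉0) (trivial α α≉0)

  translation-injective : ∀ γ {α β} → α + γ ≈ β + γ → α ≈ β
  translation-injective γ {α} {β} p = -≈0⇒≈ (≈-trans (≈-reflexive (eq α β γ)) (≈⇒-≈0 p))
    where
    eq : ∀ α β γ → α - β ≡ (α + γ) - (β + γ)
    eq = solve-∀ D-ring

  ∑-translate : (f : D → D) → (∀ {α β} → α ≈ β → f α ≡ f β) → ∀ γ → ∑ f ≡ ∑ (λ α → f (α + γ))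
  ∑-translate f f-cong γ = ∑-reindex f f-cong (λ α → α + γ) (translation-injective γ)

  ∑-product : ∀ (f g : D → D) → ∑ f * ∑ g ≡ ∑ (λ α → ∑ (λ β → f α * g β))
  ∑-product f g = begin
    ∑ f * ∑ g                     ≡⟨ Dᵣ.*-comm (∑ f) (∑ g) ⟩
    ∑ g * ∑ f                     ≡⟨ ∑-* (∑ g) f ⟩
    ∑ (λ α → ∑ g * f α)           ≡⟨ ∑-cong (λ α → trans (Dᵣ.*-comm (∑ g) (f α)) (∑-* (f α) g)) ⟩
    ∑ (λ α → ∑ (λ β → f α * g β)) ∎
    where open ≡-Reasoning

  fromℕn≢0 : fromℕ n ≢ 0D
  fromℕn≢0 p = n≢0 (ℤ.+-injective (cong re p))

  -- The autocorrelation of e. It is n at 0 and - 1 elsewhere, which is the orthogonality that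
  -- replaces additive characters.
  correlation : D → D
  correlation δ = ∑ (λ α → e α * ē (α + δ))

  correlation-zero : ∀ {δ} → δ ≈ 0D → correlation δ ≡ fromℕ n
  correlation-zero {δ} δ≈0 = trans
    (∑-split (λ α → e α * ē (α + δ))
      (λ {α} α≈0 → trans (cong (_* ē (α + δ)) (e-zero α≈0)) (Dᵣ.zeroˡ (ē (α + δ))))
      (λ {α} α≉0 → trans (cong (e α *_) (ē-cong (≈-trans (+-cong (≈-refl {α}) δ≈0)
                     (≈-reflexive (Dᵣ.+-identityʳ α))))) (e*ē α≉0)))
    (trans (Dᵣ.+-identityˡ (fromℕ n * 1D)) (Dᵣ.*-identityʳ (fromℕ n)))

  correlation-scale : ∀ {δ} → ¬ δ ≈ 0D → correlation δ ≡ correlation 1D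
  correlation-scale {δ} δ≉0 = trans
    (∑-reindex (λ α → e α * ē (α + δ))
      (λ p → cong₂ _*_ (e-cong p) (ē-cong (+-cong p (≈-refl {δ}))))
      (δ *_) (scaling-injective δ≉0))
    (∑-cong λ α → begin
      e (δ * α) * ē (δ * α + δ)         ≡⟨ cong₂ _*_ (e-* δ α) (trans (cong ē (eq₁ δ α)) (ē-* δ (α + 1D))) ⟩
      e δ * e α * (ē δ * ē (α + 1D))    ≡⟨ eq₂ (e δ) (e α) (ē δ) (ē (α + 1D)) ⟩
      e δ * ē δ * (e α * ē (α + 1D))    ≡⟨ cong (_* (e α * ē (α + 1D))) (e*ē δ≉0) ⟩
      1D * (e α * ē (α + 1D))           ≡⟨ Dᵣ.*-identityˡ (e α * ē (α + 1D)) ⟩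
      e α * ē (α + 1D)                  ∎)
    where
    open ≡-Reasoning
    eq₁ : ∀ δ α → δ * α + δ ≡ δ * (α + 1D)
    eq₁ = solve-∀ D-ring
    eq₂ : ∀ x y z w → x * y * (z * w) ≡ x * z * (y * w)
    eq₂ = solve-∀ D-ring

  ∑-correlation : ∑ correlation ≡ 0D
  ∑-correlation = begin
    ∑ (λ δ → ∑ (λ α → e α * ē (α + δ)))  ≡⟨ ∑-comm (λ δ α → e α * ē (α + δ)) ⟩
    ∑ (λ α → ∑ (λ δ → e α * ē (α + δ)))  ≡⟨ ∑-cong (λ α → sym (∑-* (e α) (λ δ → ē (α + δ)))) ⟩
    ∑ (λ α → e α * ∑ (λ δ → ē (α + δ)))  ≡⟨ ∑-cong (λ α → trans (cong (e α *_) (shifted α)) (Dᵣ.zeroʳ (e α))) ⟩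
    ∑ (λ _ → 0D)                         ≡⟨ ∑-constant 0D ⟩
    fromℕ (suc n) * 0D                   ≡⟨ Dᵣ.zeroʳ (fromℕ (suc n)) ⟩
    0D                                   ∎
    where
    open ≡-Reasoning
    shifted : ∀ α → ∑ (λ δ → ē (α + δ)) ≡ 0D
    shifted α = trans (∑-cong (λ δ → cong ē (Dᵣ.+-comm α δ))) (trans (sym (∑-translate ē ē-cong α)) ∑ē)

  -- By scaling, the correlation takes one value c off 0, so its total is n + nc. This total is 0
  -- because ∑ ē = 0, and n cancels in D.
  correlation-1 : correlation 1D ≡ - 1D
  correlation-1 = D-*-cancelˡ (fromℕ n) (correlation 1D) (- 1D) fromℕn≢0
    (solve-for (fromℕ n) (correlation 1D)
      (trans (sym (∑-split correlation correlation-zero correlation-scale)) ∑-correlation))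
    where
    eq : ∀ x y → x * y ≡ (x + x * y) + x * - 1D
    eq = solve-∀ D-ring
    solve-for : ∀ x y → x + x * y ≡ 0D → x * y ≡ x * - 1D
    solve-for x y p = trans (eq x y) (trans (cong (λ z → z + x * - 1D) p) (Dᵣ.+-identityˡ (x * - 1D)))

  correlation-nonzero : ∀ {δ} → ¬ δ ≈ 0D → correlation δ ≡ - 1D
  correlation-nonzero δ≉0 = trans (correlation-scale δ≉0) correlation-1

  correlation-cong : ∀ {α β} → α ≈ β → correlation α ≡ correlation β
  correlation-cong p = ∑-cong (λ x → cong (e x *_) (ē-cong (+-cong (≈-refl {x}) p)))

  J J̄ : D
  J = ∑ (λ α → e α * e (1D - α))
  J̄ = ∑ (λ α → ē α * ē (1D - α))

  -- The additive self-convolution of h, the coefficient at γ of the square of a Gauss sum. At γ = 1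
  -- it is the Jacobi sum.
  convolution : (D → D) → D → D
  convolution h γ = ∑ (λ α → h α * h (γ - α))

  convolution-scale : (h : D → D) → (∀ {α β} → α ≈ β → h α ≡ h β) → (∀ α β → h (α * β) ≡ h α * h β) →
                      ∀ {γ} → ¬ γ ≈ 0D → convolution h γ ≡ h γ * h γ * convolution h 1D
  convolution-scale h h-cong h-* {γ} γ≉0 = begin
    ∑ (λ α → h α * h (γ - α))
      ≡⟨ ∑-reindex (λ α → h α * h (γ - α))
           (λ p → cong₂ _*_ (h-cong p) (h-cong (+-cong (≈-refl {γ}) (-‿cong p))))
           (γ *_) (scaling-injective γ≉0) ⟩
    ∑ (λ α → h (γ * α) * h (γ - γ * α))
      ≡⟨ ∑-cong (λ α → trans
           (cong₂ _*_ (h-* γ α) (trans (cong h (eq₁ γ α)) (h-* γ (1D - α))))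
           (eq₂ (h γ) (h α) (h (1D - α)))) ⟩
    ∑ (λ α → h γ * h γ * (h α * h (1D - α)))
      ≡⟨ ∑-* (h γ * h γ) (λ α → h α * h (1D - α)) ⟨
    h γ * h γ * convolution h 1D ∎
    where
    open ≡-Reasoning
    eq₁ : ∀ γ α → γ - γ * α ≡ γ * (1D - α)
    eq₁ = solve-∀ D-ring
    eq₂ : ∀ x y z → x * y * (x * z) ≡ x * x * (y * z)
    eq₂ = solve-∀ D-ring

  0D-neg : ∀ {γ} α → γ ≈ 0D → γ - α ≈ - α
  0D-neg α p = ≈-trans (+-cong p (≈-refl { - α})) (≈-reflexive (Dᵣ.+-identityˡ (- α)))

  convolution-zero : ∀ {γ} → γ ≈ 0D → convolution e γ ≡ 0D
  convolution-zero {γ} γ≈0 = trans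
    (∑-cong (λ α → cong (e α *_) (trans (e-cong (0D-neg α γ≈0)) (e-neg α)))) ∑ē

  -- For γ ≠ 0 the factors e(γ)² and ē(γ)² from scaling cancel, which leaves J J̄. At γ = 0 the
  -- convolution of e is e(- 1) ∑ ē = 0.
  ∑-convolutions : ∑ (λ γ → convolution e γ * convolution ē γ) ≡ fromℕ n * (J * J̄)
  ∑-convolutions = trans
    (∑-split (λ γ → convolution e γ * convolution ē γ) {0D} {J * J̄}
      (λ {γ} γ≈0 → trans (cong (_* convolution ē γ) (convolution-zero γ≈0)) (Dᵣ.zeroˡ (convolution ē γ)))
      (λ {γ} γ≉0 → begin
        convolution e γ * convolution ē γ
          ≡⟨ cong₂ _*_ (convolution-scale e e-cong e-* γ≉0) (convolution-scale ē ē-cong ē-* γ≉0) ⟩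
        ē γ * J * (ē γ * ē γ * J̄)
          ≡⟨ eq (e γ) J J̄ ⟩
        e γ * ē γ * (e γ * ē γ) * (J * J̄)
          ≡⟨ cong (λ z → z * z * (J * J̄)) (e*ē γ≉0) ⟩
        1D * 1D * (J * J̄)
          ≡⟨ Dᵣ.*-identityˡ (J * J̄) ⟩
        J * J̄ ∎))
    (Dᵣ.+-identityˡ (fromℕ n * (J * J̄)))
    where
    open ≡-Reasoning
    eq : ∀ x y z → x * x * y * (x * x * (x * x) * z) ≡ x * (x * x) * (x * (x * x)) * (y * z)
    eq = solve-∀ D-ring

  -- Raised by 1, the correlation is concentrated at β = α, where it is n + 1; the compensating - 1
  -- contributes - ∑ ē = 0.
  ∑-ē*correlation : ∀ α → ∑ (λ β → ē β * correlation (α - β)) ≡ fromℕ (suc n) * ē α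
  ∑-ē*correlation α = begin
    ∑ (λ β → ē β * correlation (α - β))
      ≡⟨ ∑-cong (λ β → eq₁ (ē β) (correlation (α - β))) ⟩
    ∑ (λ β → f β + - 1D * ē β)
      ≡⟨ ∑-+ f (λ β → - 1D * ē β) ⟩
    ∑ f + ∑ (λ β → - 1D * ē β)
      ≡⟨ cong₂ _+_ (∑-point f f-cong α f-zero)
           (trans (sym (∑-* (- 1D) ē)) (trans (cong (- 1D *_) ∑ē) (Dᵣ.zeroʳ (- 1D)))) ⟩
    ē α * (correlation (α - α) + 1D) + 0D
      ≡⟨ cong (λ z → ē α * (z + 1D) + 0D)
           (correlation-zero (≈-reflexive (Dᵣ.-‿inverseʳ α))) ⟩
    ē α * (fromℕ n + 1D) + 0D
      ≡⟨ eq₂ (ē α) (fromℕ n) ⟩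
    ē α + fromℕ n * ē α
      ≡⟨ fromℕ-suc n (ē α) ⟩
    fromℕ (suc n) * ē α ∎
    where
    open ≡-Reasoning
    f : D → D
    f β = ē β * (correlation (α - β) + 1D)
    f-cong : ∀ {β γ} → β ≈ γ → f β ≡ f γ
    f-cong p = cong₂ (λ y z → y * (z + 1D)) (ē-cong p)
      (correlation-cong (+-cong (≈-refl {α}) (-‿cong p)))
    f-zero : ∀ {β} → ¬ β ≈ α → f β ≡ 0D
    f-zero {β} β≉α = trans (cong (λ z → ē β * (z + 1D))
      (correlation-nonzero (λ p → β≉α (≈-sym (-≈0⇒≈ p))))) (Dᵣ.zeroʳ (ē β))
    eq₁ : ∀ x y → x * y ≡ x * (y + 1D) + - 1D * x
    eq₁ = solve-∀ D-ring
    eq₂ : ∀ x y → x * (y + 1D) + 0D ≡ x + y * x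
    eq₂ = solve-∀ D-ring

  ∑-shifted-product : ∀ α β → ∑ (λ γ → e (γ - α) * ē (γ - β)) ≡ correlation (α - β)
  ∑-shifted-product α β = trans
    (∑-translate (λ γ → e (γ - α) * ē (γ - β))
      (λ p → cong₂ _*_ (e-cong (+-cong p (≈-refl { - α}))) (ē-cong (+-cong p (≈-refl { - β})))) α)
    (∑-cong (λ γ → cong₂ (λ x y → e x * ē y) (eq₁ γ α) (eq₂ γ α β)))
    where
    eq₁ : ∀ γ α → γ + α - α ≡ γ
    eq₁ = solve-∀ D-ring
    eq₂ : ∀ γ α β → γ + α - β ≡ γ + (α - β)
    eq₂ = solve-∀ D-ring

  -- With γ summed innermost, the factors that contain γ give the correlation at α - β. Summing over
  -- β leaves (n + 1) e(α) ē(α), which is n + 1 for each of the n nonzero α.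
  ∑-convolutions′ : ∑ (λ γ → convolution e γ * convolution ē γ) ≡ fromℕ n * fromℕ (suc n)
  ∑-convolutions′ = begin
    ∑ (λ γ → convolution e γ * convolution ē γ)
      ≡⟨ ∑-cong (λ γ → ∑-product (λ α → e α * e (γ - α)) (λ β → ē β * ē (γ - β))) ⟩
    ∑ (λ γ → ∑ (λ α → ∑ (λ β → F γ α β)))
      ≡⟨ ∑-comm (λ γ α → ∑ (λ β → F γ α β)) ⟩
    ∑ (λ α → ∑ (λ γ → ∑ (λ β → F γ α β)))
      ≡⟨ ∑-cong (λ α → ∑-comm (λ γ β → F γ α β)) ⟩
    ∑ (λ α → ∑ (λ β → ∑ (λ γ → F γ α β)))
      ≡⟨ ∑-cong (λ α → ∑-cong (λ β → inner α β)) ⟩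
    ∑ (λ α → ∑ (λ β → e α * (ē β * correlation (α - β))))
      ≡⟨ ∑-cong (λ α → trans (sym (∑-* (e α) (λ β → ē β * correlation (α - β))))
           (cong (e α *_) (∑-ē*correlation α))) ⟩
    ∑ (λ α → e α * (fromℕ (suc n) * ē α))
      ≡⟨ ∑-split (λ α → e α * (fromℕ (suc n) * ē α)) {0D} {fromℕ (suc n)}
           (λ {α} p → trans (cong (_* (fromℕ (suc n) * ē α)) (e-zero p)) (Dᵣ.zeroˡ (fromℕ (suc n) * ē α)))
           (λ {α} p → trans (eq₂ (e α) (fromℕ (suc n)) (ē α))
             (trans (cong (fromℕ (suc n) *_) (e*ē p)) (Dᵣ.*-identityʳ (fromℕ (suc n))))) ⟩
    0D + fromℕ n * fromℕ (suc n)
      ≡⟨ Dᵣ.+-identityˡ (fromℕ n * fromℕ (suc n)) ⟩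
    fromℕ n * fromℕ (suc n) ∎
    where
    open ≡-Reasoning
    F : D → D → D → D
    F γ α β = e α * e (γ - α) * (ē β * ē (γ - β))
    eq₁ : ∀ x y z w → x * y * (z * w) ≡ x * z * (y * w)
    eq₁ = solve-∀ D-ring
    eq₂ : ∀ x y z → x * (y * z) ≡ y * (x * z)
    eq₂ = solve-∀ D-ring
    inner : ∀ α β → ∑ (λ γ → F γ α β) ≡ e α * (ē β * correlation (α - β))
    inner α β = begin
      ∑ (λ γ → F γ α β)
        ≡⟨ ∑-cong (λ γ → eq₁ (e α) (e (γ - α)) (ē β) (ē (γ - β))) ⟩
      ∑ (λ γ → e α * ē β * (e (γ - α) * ē (γ - β)))
        ≡⟨ ∑-* (e α * ē β) (λ γ → e (γ - α) * ē (γ - β)) ⟨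
      e α * ē β * ∑ (λ γ → e (γ - α) * ē (γ - β))
        ≡⟨ cong (e α * ē β *_) (∑-shifted-product α β) ⟩
      e α * ē β * correlation (α - β)
        ≡⟨ Dᵣ.*-assoc (e α) (ē β) (correlation (α - β)) ⟩
      e α * (ē β * correlation (α - β)) ∎

  J*J̄ : J * J̄ ≡ fromℕ (suc n)
  J*J̄ = D-*-cancelˡ (fromℕ n) (J * J̄) (fromℕ (suc n)) fromℕn≢0
    (trans (sym ∑-convolutions) ∑-convolutions′)

-- Sums over the kernel of a cubic character

does≡true : ∀ {P : Set} (p? : Dec P) → does p? ≡ true → P
does≡true (yes p) _ = p

3D : D
3D = fromℤ (+ 3)

count-sum : ∀ {m} (s : Fin m → Bool) → sum (λ i → if s i then 1D else 0D) ≡ fromℕ (count s)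
count-sum {zero}  s = refl
count-sum {suc m} s = trans (cong (λ z → (if s zero then 1D else 0D) + z) (count-sum (s ∘ suc)))
                            (step (s zero) (count (s ∘ suc)))
  where
  step : ∀ b k → (if b then 1D else 0D) + fromℕ k ≡ fromℕ (if b then suc k else k)
  step true  k = refl
  step false k = Dᵣ.+-identityˡ (fromℕ k)

module SubgroupSums {π : D} {n : ℕ} (π-prime : Prime π) (system : ResidueSystem π (suc n)) (n≢0 : n ≢ 0)
                    (e : D → D) (isCubicCharacter : IsCubicCharacter π e) where
  open Congruence π
  open PrimeModulus π-prime
  open ResidueSystem system
  open Residues system
  open FiniteField π-prime system
  open IsCubicCharacter isCubicCharacter
  open CharacterSums π-prime system n≢0 e isCubicCharacter

  -- The kernel of e without the identity.
  kernel? : ∀ α → Dec (e α ≡ 1D × ¬ α - 1D ≈ 0D)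
  kernel? α = (e α ≟ 1D) ×-dec ¬? (≈0? (α - 1D))

  inKernel : D → Bool
  inKernel α = does (kernel? α)

  indicator : ∀ a v → ∑ (λ α → ifZero (α - a) v 0D) ≡ v
  indicator a v = trans
    (∑-point (λ α → ifZero (α - a) v 0D) f-cong a (λ α≉a → ifZero-no (λ p → α≉a (-≈0⇒≈ p))))
    (ifZero-yes (≈⇒-≈0 (≈-refl {a})))
    where
    f-cong : ∀ {α β} → α ≈ β → ifZero (α - a) v 0D ≡ ifZero (β - a) v 0D
    f-cong {α} {β} p = byZero (α - a)
      (λ q → trans (ifZero-yes q) (sym (ifZero-yes (≈-trans (≈-sym p-a) q))))
      (λ q → trans (ifZero-no q) (sym (ifZero-no (λ r → q (≈-trans p-a r)))))
      where
      p-a : α - a ≈ β - a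
      p-a = +-cong p (≈-refl { - a})

  -- The weight 1 + e + ē is 1 at 0, 3 where e is 1, and 0 elsewhere because 1 + ω + ω² = 0. The
  -- identity is kept apart because the product of the 1 - z has to omit it.
  ∑-kernel : (g : D → D) → (∀ {α β} → α ≈ β → g α ≡ g β) →
             ∑ (λ α → g α * (1D + (e α + ē α))) ≡
             g 0D + (3D * g 1D + 3D * ∑ (λ α → if inKernel α then g α else 0D))
  ∑-kernel g g-cong = begin
    ∑ (λ α → g α * (1D + (e α + ē α)))
      ≡⟨ ∑-cong pointwise ⟩
    ∑ (λ α → f₀ α + (f₁ α + 3D * h α))
      ≡⟨ ∑-+ f₀ (λ α → f₁ α + 3D * h α) ⟩
    ∑ f₀ + ∑ (λ α → f₁ α + 3D * h α)
      ≡⟨ cong (λ z → ∑ f₀ + z) (∑-+ f₁ (λ α → 3D * h α)) ⟩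
    ∑ f₀ + (∑ f₁ + ∑ (λ α → 3D * h α))
      ≡⟨ cong₂ _+_ (indicator 0D (g 0D)) (cong₂ _+_ (indicator 1D (3D * g 1D)) (sym (∑-* 3D h))) ⟩
    g 0D + (3D * g 1D + 3D * ∑ h) ∎
    where
    open ≡-Reasoning
    f₀ f₁ h : D → D
    f₀ α = ifZero (α - 0D) (g 0D) 0D
    f₁ α = ifZero (α - 1D) (3D * g 1D) 0D
    h α  = if inKernel α then g α else 0D
    h-yes : ∀ {α} → e α ≡ 1D → ¬ α - 1D ≈ 0D → h α ≡ g α
    h-yes {α} p q = cong (λ b → if b then g α else 0D) (dec-true (kernel? α) (p , q))
    h-no : ∀ {α} → ¬ (e α ≡ 1D × ¬ α - 1D ≈ 0D) → h α ≡ 0D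
    h-no {α} p = cong (λ b → if b then g α else 0D) (dec-false (kernel? α) p)
    assemble : ∀ {a b c x y z} → a ≡ x → b ≡ y → c ≡ z → a + (b + 3D * c) ≡ x + (y + 3D * z)
    assemble refl refl refl = refl
    at-root : ∀ {γ} x → CubeRootOfUnity γ → γ ≢ 1D → x * (1D + (γ + γ * γ)) ≡ 0D + (0D + 3D * 0D)
    at-root x (inj₁ refl)        p = contradiction refl p
    at-root x (inj₂ (inj₁ refl)) p = Dᵣ.zeroʳ x
    at-root x (inj₂ (inj₂ refl)) p = Dᵣ.zeroʳ x
    eq₁ : ∀ x → x * (1D + (1D + 1D * 1D)) ≡ 0D + (0D + 3D * x)
    eq₁ = solve-∀ D-ring
    eq₂ : ∀ x → x * (1D + (1D + 1D * 1D)) ≡ 0D + (3D * x + 3D * 0D)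
    eq₂ = solve-∀ D-ring
    eq₃ : ∀ x → x * (1D + (0D + 0D * 0D)) ≡ x + (0D + 3D * 0D)
    eq₃ = solve-∀ D-ring
    byUnity : ∀ {P : Set} α → (e α ≡ 1D → P) → (e α ≢ 1D → P) → P
    byUnity {P} α f g = go (e α ≟ 1D)
      where
      go : Dec (e α ≡ 1D) → P
      go (yes p) = f p
      go (no p)  = g p
    value : ∀ {x} α → e α ≡ x → g α * (1D + (e α + ē α)) ≡ g α * (1D + (x + x * x))
    value α refl = refl
    pointwise : ∀ α → g α * (1D + (e α + ē α)) ≡ f₀ α + (f₁ α + 3D * h α)
    pointwise α = byZero (α - 0D)
      (λ p → let α≈0 = -≈0⇒≈ {α} {0D} p in
        trans (value α (e-zero α≈0)) (trans (eq₃ (g α)) (sym (assemble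
          (trans (ifZero-yes p) (g-cong (≈-sym α≈0)))
          (ifZero-no (λ q → 1≉0 (≈-trans (≈-sym (-≈0⇒≈ {α} {1D} q)) α≈0)))
          (h-no (λ (q , _) → contradiction (trans (sym q) (e-zero α≈0)) λ ()))))))
      (λ α-0≉0 → let α≉0 = λ p → α-0≉0 (≈⇒-≈0 {α} {0D} p) in byZero (α - 1D)
        (λ p → let α≈1 = -≈0⇒≈ {α} {1D} p in
          trans (value α (trans (e-cong α≈1) e-1)) (trans (eq₂ (g α)) (sym (assemble
            (ifZero-no α-0≉0)
            (trans (ifZero-yes p) (cong (3D *_) (g-cong (≈-sym α≈1))))
            (h-no (λ (_ , q) → q p))))))
        (λ α-1≉0 → byUnity α
          (λ eα≡1 → trans (value α eα≡1) (trans (eq₁ (g α)) (sym (assemble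
            (ifZero-no α-0≉0) (ifZero-no α-1≉0) (h-yes eα≡1 α-1≉0)))))
          (λ eα≢1 → trans (at-root (g α) (e-root α≉0) eα≢1) (sym (assemble
            (ifZero-no α-0≉0) (ifZero-no α-1≉0) (h-no (λ (q , _) → eα≢1 q)))))))

  kernel-sum : D
  kernel-sum = ∑ (λ α → if inKernel α then e (α - 1D) else 0D)

  -- This is `∑-kernel` with constant weight 1, where the sums of e and ē vanish. The 4 is 1 from
  -- the residue 0 and 3 from the identity.
  kernel-count : suc n ≡ 4 ℕ.+ 3 ℕ.* count (λ i → inKernel (rep i))
  kernel-count = ℤ.+-injective (cong re (begin
    fromℕ (suc n)
      ≡⟨ Dᵣ.*-identityʳ (fromℕ (suc n)) ⟨
    fromℕ (suc n) * 1D
      ≡⟨ eq₁ (fromℕ (suc n) * 1D) ⟩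
    fromℕ (suc n) * 1D + (0D + 0D)
      ≡⟨ cong₂ _+_ (∑-constant 1D) (cong₂ _+_ ∑e ∑ē) ⟨
    ∑ (λ _ → 1D) + (∑ e + ∑ ē)
      ≡⟨ cong (λ z → ∑ (λ _ → 1D) + z) (∑-+ e ē) ⟨
    ∑ (λ _ → 1D) + ∑ (λ α → e α + ē α)
      ≡⟨ ∑-+ (λ _ → 1D) (λ α → e α + ē α) ⟨
    ∑ (λ α → 1D + (e α + ē α))
      ≡⟨ ∑-cong (λ α → Dᵣ.*-identityˡ (1D + (e α + ē α))) ⟨
    ∑ (λ α → 1D * (1D + (e α + ē α)))
      ≡⟨ ∑-kernel (λ _ → 1D) (λ _ → refl) ⟩
    1D + (3D * 1D + 3D * ∑ (λ α → if inKernel α then 1D else 0D))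
      ≡⟨ cong (λ z → 1D + (3D * 1D + 3D * z)) (count-sum (λ i → inKernel (rep i))) ⟩
    1D + (3D * 1D + 3D * fromℕ k)
      ≡⟨ cong (λ z → 1D + (3D * 1D + z)) (fromℕ-* 3 k) ⟩
    fromℕ (4 ℕ.+ 3 ℕ.* k) ∎))
    where
    open ≡-Reasoning
    k = count (λ i → inKernel (rep i))
    eq₁ : ∀ x → x ≡ x + (0D + 0D)
    eq₁ = solve-∀ D-ring

  -- Apply `∑-kernel` to e(α - 1). The three sums on the left are 0, then J because e(- 1) = 1, and
  -- the correlation - 1 at shift 1; on the right, the weight is 1 at 0 and 0 at 1.
  J-kernel : J ≡ 1D + 1D + 3D * kernel-sum
  J-kernel = begin
    J
      ≡⟨ eq₁ J ⟩
    (0D + (J + - 1D)) + 1D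
      ≡⟨ cong (λ z → z + 1D) (cong₂ _+_ first (cong₂ _+_ second third)) ⟨
    (∑ g + (∑ (λ α → g α * e α) + ∑ (λ α → g α * ē α))) + 1D
      ≡⟨ cong (λ z → (∑ g + z) + 1D) (∑-+ (λ α → g α * e α) (λ α → g α * ē α)) ⟨
    (∑ g + ∑ (λ α → g α * e α + g α * ē α)) + 1D
      ≡⟨ cong (λ z → z + 1D) (∑-+ g (λ α → g α * e α + g α * ē α)) ⟨
    ∑ (λ α → g α + (g α * e α + g α * ē α)) + 1D
      ≡⟨ cong (λ z → z + 1D) (∑-cong (λ α → eq₂ (g α) (e α) (ē α))) ⟨
    ∑ (λ α → g α * (1D + (e α + ē α))) + 1D
      ≡⟨ cong (λ z → z + 1D) (∑-kernel g g-cong) ⟩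
    g 0D + (3D * g 1D + 3D * kernel-sum) + 1D
      ≡⟨ cong₂ (λ x y → x + (3D * y + 3D * kernel-sum) + 1D) e--1 (e-zero (≈-refl {0D})) ⟩
    1D + (3D * 0D + 3D * kernel-sum) + 1D
      ≡⟨ eq₃ kernel-sum ⟩
    1D + 1D + 3D * kernel-sum ∎
    where
    open ≡-Reasoning
    g : D → D
    g α = e (α - 1D)
    g-cong : ∀ {α β} → α ≈ β → g α ≡ g β
    g-cong p = e-cong (+-cong p (≈-refl { - 1D}))
    first : ∑ g ≡ 0D
    first = trans (sym (∑-translate e e-cong (- 1D))) ∑e
    second : ∑ (λ α → g α * e α) ≡ J
    second = ∑-cong λ α → trans (Dᵣ.*-comm (g α) (e α))
      (cong (e α *_) (trans (cong e (swap α)) (e-neg (1D - α))))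
      where
      swap : ∀ α → α - 1D ≡ - (1D - α)
      swap = solve-∀ D-ring
    third : ∑ (λ α → g α * ē α) ≡ - 1D
    third = trans (∑-translate (λ α → g α * ē α) (λ p → cong₂ _*_ (g-cong p) (ē-cong p)) 1D)
      (trans (∑-cong (λ α → cong (λ z → e z * ē (α + 1D)) (cancel α))) correlation-1)
      where
      cancel : ∀ α → α + 1D - 1D ≡ α
      cancel = solve-∀ D-ring
    eq₁ : ∀ x → x ≡ (0D + (x + - 1D)) + 1D
    eq₁ = solve-∀ D-ring
    eq₂ : ∀ x y z → x * (1D + (y + z)) ≡ x + (x * y + x * z)
    eq₂ = solve-∀ D-ring
    eq₃ : ∀ x → 1D + (3D * 0D + 3D * x) + 1D ≡ 1D + 1D + 3D * x
    eq₃ = solve-∀ D-ring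

-- The Jacobi sum modulo 9

CubeRootOfUnity-* : ∀ {γ δ} → CubeRootOfUnity γ → CubeRootOfUnity δ → CubeRootOfUnity (γ * δ)
CubeRootOfUnity-* (inj₁ refl)        (inj₁ refl)        = inj₁ refl
CubeRootOfUnity-* (inj₁ refl)        (inj₂ (inj₁ refl)) = inj₂ (inj₁ refl)
CubeRootOfUnity-* (inj₁ refl)        (inj₂ (inj₂ refl)) = inj₂ (inj₂ refl)
CubeRootOfUnity-* (inj₂ (inj₁ refl)) (inj₁ refl)        = inj₂ (inj₁ refl)
CubeRootOfUnity-* (inj₂ (inj₁ refl)) (inj₂ (inj₁ refl)) = inj₂ (inj₂ refl)
CubeRootOfUnity-* (inj₂ (inj₁ refl)) (inj₂ (inj₂ refl)) = inj₁ refl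
CubeRootOfUnity-* (inj₂ (inj₂ refl)) (inj₁ refl)        = inj₂ (inj₂ refl)
CubeRootOfUnity-* (inj₂ (inj₂ refl)) (inj₂ (inj₁ refl)) = inj₁ refl
CubeRootOfUnity-* (inj₂ (inj₂ refl)) (inj₂ (inj₂ refl)) = inj₂ (inj₁ refl)

CubeRootOfUnity-^ : ∀ {γ} → CubeRootOfUnity γ → ∀ k → CubeRootOfUnity (γ ^ k)
CubeRootOfUnity-^ γ-root zero    = inj₁ refl
CubeRootOfUnity-^ γ-root (suc k) = CubeRootOfUnity-* γ-root (CubeRootOfUnity-^ γ-root k)

CubeRootOfUnity-product : ∀ {m} (v : Fin m → D) → (∀ i → CubeRootOfUnity (v i)) → CubeRootOfUnity (product v)
CubeRootOfUnity-product {zero}  v roots = inj₁ refl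
CubeRootOfUnity-product {suc m} v roots =
  CubeRootOfUnity-* (roots zero) (CubeRootOfUnity-product (v ∘ suc) (roots ∘ suc))

root-1 : ∀ {γ} → CubeRootOfUnity γ → ∃[ κ ] γ - 1D ≡ (ω - 1D) * κ
root-1 (inj₁ refl)        = 0D , refl
root-1 (inj₂ (inj₁ refl)) = 1D , refl
root-1 (inj₂ (inj₂ refl)) = 1D + ω , refl

-- (u - 1)(v - 1) is a multiple of (ω - 1)² = - 3ω, so u ↦ u - 1 turns products into sums modulo 3.
sum≡product : ∀ {m} (v : Fin m → D) → (∀ i → CubeRootOfUnity (v i)) →
              ∃[ δ ] sum (λ i → v i - 1D) ≡ product v - 1D + 3D * δ
sum≡product {zero}  v roots = 0D , refl
sum≡product {suc m} v roots
  with sum≡product (v ∘ suc) (roots ∘ suc) | root-1 (roots zero)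
     | root-1 (CubeRootOfUnity-product (v ∘ suc) (roots ∘ suc))
... | δ , p | κ , q | μ , r = δ + ω * κ * μ , (begin
  v zero - 1D + sum (λ i → v (suc i) - 1D)
    ≡⟨ cong (λ z → v zero - 1D + z) p ⟩
  v zero - 1D + (P - 1D + 3D * δ)
    ≡⟨ eq₁ (v zero) P δ ⟩
  v zero * P - 1D + 3D * δ - (v zero - 1D) * (P - 1D)
    ≡⟨ cong₂ (λ x y → v zero * P - 1D + 3D * δ - x * y) q r ⟩
  v zero * P - 1D + 3D * δ - (ω - 1D) * κ * ((ω - 1D) * μ)
    ≡⟨ eq₂ (v zero * P - 1D) δ κ μ ⟩
  v zero * P - 1D + 3D * (δ + ω * κ * μ) ∎)
  where
  open ≡-Reasoning
  P = product (v ∘ suc)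
  eq₁ : ∀ x y δ → x - 1D + (y - 1D + 3D * δ) ≡ x * y - 1D + 3D * δ - (x - 1D) * (y - 1D)
  eq₁ = solve-∀ D-ring
  eq₂ : ∀ x δ κ μ → x + 3D * δ - (ω - 1D) * κ * ((ω - 1D) * μ) ≡ x + 3D * (δ + ω * κ * μ)
  eq₂ = solve-∀ D-ring

geometric : ∀ d x → (x - 1D) * eval (replicate d 1D) x ≡ x ^ suc d - 1D
geometric zero    x = eq x
  where
  eq : ∀ x → (x - 1D) * 1D ≡ x * 1D - 1D
  eq = solve-∀ D-ring
geometric (suc d) x = trans (eq₁ x (eval (replicate d 1D) x))
  (trans (cong (λ z → x - 1D + x * z) (geometric d x)) (eq₂ x (x ^ suc d)))
  where
  eq₁ : ∀ x y → (x - 1D) * (1D + x * y) ≡ x - 1D + x * ((x - 1D) * y)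
  eq₁ = solve-∀ D-ring
  eq₂ : ∀ x y → x - 1D + x * (y - 1D) ≡ x * y - 1D
  eq₂ = solve-∀ D-ring

geometric-1 : ∀ d → eval (replicate d 1D) 1D ≡ fromℕ (suc d)
geometric-1 zero    = refl
geometric-1 (suc d) = cong (λ z → 1D + z) (trans (Dᵣ.*-identityˡ (eval (replicate d 1D) 1D)) (geometric-1 d))

conj-+ : ∀ α β → conj (α + β) ≡ conj α + conj β
conj-+ (a +ω· b) (c +ω· d) = cong₂ _+ω·_ (eq a b c d) (ℤ.neg-distrib-+ b d)
  where
  eq : ∀ a b c d → (a ℤ.+ c) ℤ.- (b ℤ.+ d) ≡ (a ℤ.- b) ℤ.+ (c ℤ.- d)
  eq = ℤ-Solver.solve-∀

conj-* : ∀ α β → conj (α * β) ≡ conj α * conj β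
conj-* (a +ω· b) (c +ω· d) = cong₂ _+ω·_ (eq₁ a b c d) (eq₂ a b c d)
  where
  eq₁ : ∀ a b c d → a ℤ.* c ℤ.- b ℤ.* d ℤ.- (a ℤ.* d ℤ.+ b ℤ.* c ℤ.- b ℤ.* d) ≡
                    (a ℤ.- b) ℤ.* (c ℤ.- d) ℤ.- ℤ.- b ℤ.* ℤ.- d
  eq₁ = ℤ-Solver.solve-∀
  eq₂ : ∀ a b c d → ℤ.- (a ℤ.* d ℤ.+ b ℤ.* c ℤ.- b ℤ.* d) ≡
                    (a ℤ.- b) ℤ.* ℤ.- d ℤ.+ ℤ.- b ℤ.* (c ℤ.- d) ℤ.- ℤ.- b ℤ.* ℤ.- d
  eq₂ = ℤ-Solver.solve-∀

conj-sum : ∀ {m} (f : Fin m → D) → conj (sum f) ≡ sum (λ i → conj (f i))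
conj-sum {zero}  f = refl
conj-sum {suc m} f = trans (conj-+ (f zero) (sum (f ∘ suc)))
  (cong (λ z → conj (f zero) + z) (conj-sum (f ∘ suc)))

module JacobiSum {π : D} {M : ℕ} (π-prime : Prime π) (system : ResidueSystem π (suc (3 ℕ.* suc M)))
                 (e : D → D) (isCubicCharacter : IsCubicCharacter π e)
                 (e-power : ∀ α → Congruence._≈_ π (e α) (α ^ suc M)) where
  open Congruence π
  open PrimeModulus π-prime
  open ResidueSystem system
  open Residues system
  open FiniteField π-prime system
  open IsCubicCharacter isCubicCharacter
  open CharacterSums π-prime system (λ ()) e isCubicCharacter public
  open SubgroupSums π-prime system (λ ()) e isCubicCharacter

  J≈0 : J ≈ 0D
  J≈0 = ≈-trans (∑-cong-≈ (λ α → *-cong (e-power α) (e-power (1D - α))))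
    (∑-power-product (suc M) (suc M) (ℕ.s≤s ℕ.z≤n)
      (ℕ.+-monoʳ-< (suc M) (ℕ.m<m+n (suc M) (ℕ.s≤s ℕ.z≤n))))

  kernel-count≡M : count (λ i → inKernel (rep i)) ≡ M
  kernel-count≡M = sym (ℕ.suc-injective (ℕ.*-cancelˡ-≡ (suc M) (suc k) 3
    (ℕ.suc-injective (trans kernel-count (cong suc (sym (ℕ.*-suc 3 k)))))))
    where k = count (λ i → inKernel (rep i))

  e-product : ∀ {m} (w : Fin m → D) → e (product w) ≡ product (λ i → e (w i))
  e-product {zero}  w = e-1
  e-product {suc m} w = trans (e-* (w zero) (product (w ∘ suc))) (cong (e (w zero) *_) (e-product (w ∘ suc)))

  kernel-factor : D → D
  kernel-factor α = if inKernel α then 1D - α else 1D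

  kernel-product : product (λ i → kernel-factor (rep i)) ≈ fromℕ (suc M)
  kernel-product = ≈-trans
    (≈-sym (roots-product rep rep-injective (λ i → inKernel (rep i)) kernel-count≡M
      (replicate M 1D) (λ i → root (rep i)) 1D))
    (≈-reflexive (geometric-1 M))
    where
    root : ∀ α → inKernel α ≡ true → eval (replicate M 1D) α ≈ 0D
    root α s = *-cancelˡ-≈0 {α - 1D} (proj₂ kernel)
      (≈-trans (≈-reflexive (geometric M α))
        (≈⇒-≈0 (≈-trans (≈-sym (e-power α)) (≈-reflexive (proj₁ kernel)))))
      where kernel = does≡true (kernel? α) s

  kernel-root : ∀ α → CubeRootOfUnity (e (kernel-factor α))
  kernel-root α = go (kernel? α)
    where
    go : (k : Dec (e α ≡ 1D × ¬ α - 1D ≈ 0D)) → CubeRootOfUnity (e (if does k then 1D - α else 1D))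
    go (yes (_ , α≉1)) = e-root λ p → α≉1 (≈⇒-≈0 (≈-sym (-≈0⇒≈ {1D} {α} p)))
    go (no _)          = inj₁ e-1

  -- Each kernel term is split as (e - 1) + 1. The first parts are of the form required by
  -- `sum≡product`, where residues outside the kernel contribute e(1) - 1 = 0; the ones add up to
  -- the size `M` of the kernel.
  kernel-sum-mod3 : ∃[ δ ] kernel-sum ≡ e (fromℕ (suc M)) - 1D + 3D * δ + fromℕ M
  kernel-sum-mod3 = proj₁ additive , (begin
    ∑ (λ α → if inKernel α then e (α - 1D) else 0D)
      ≡⟨ ∑-cong (λ α → pointwise α (inKernel α)) ⟩
    ∑ (λ α → (e (kernel-factor α) - 1D) + (if inKernel α then 1D else 0D))
      ≡⟨ ∑-+ (λ α → e (kernel-factor α) - 1D) (λ α → if inKernel α then 1D else 0D) ⟩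
    ∑ (λ α → e (kernel-factor α) - 1D) + ∑ (λ α → if inKernel α then 1D else 0D)
      ≡⟨ cong₂ _+_ (proj₂ additive)
           (trans (count-sum (λ i → inKernel (rep i))) (cong fromℕ kernel-count≡M)) ⟩
    product (λ i → e (kernel-factor (rep i))) - 1D + 3D * proj₁ additive + fromℕ M
      ≡⟨ cong (λ z → z - 1D + 3D * proj₁ additive + fromℕ M)
           (trans (sym (e-product (λ i → kernel-factor (rep i)))) (e-cong kernel-product)) ⟩
    e (fromℕ (suc M)) - 1D + 3D * proj₁ additive + fromℕ M ∎)
    where
    open ≡-Reasoning
    additive = sum≡product (λ i → e (kernel-factor (rep i))) (λ i → kernel-root (rep i))
    swap : ∀ α → α - 1D ≡ - (1D - α)
    swap = solve-∀ D-ring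
    eq : ∀ x → x ≡ x - 1D + 1D
    eq = solve-∀ D-ring
    pointwise : ∀ α b → (if b then e (α - 1D) else 0D) ≡
                (e (if b then 1D - α else 1D) - 1D) + (if b then 1D else 0D)
    pointwise α true  = trans (trans (cong e (swap α)) (e-neg (1D - α))) (eq (e (1D - α)))
    pointwise α false = sym (cong (λ z → z - 1D + 0D) e-1)

  J-mod9 : ∃[ δ ] J ≡ 1D + 1D + 3D * (e (fromℕ (suc M)) - 1D + 3D * δ + fromℕ M)
  J-mod9 = proj₁ kernel-sum-mod3
         , trans J-kernel (cong (λ z → 1D + 1D + 3D * z) (proj₂ kernel-sum-mod3))

  conj-e : ∀ α → conj (e α) ≡ ē α
  conj-e α = byZero α
    (λ α≈0 → trans (cong conj (e-zero α≈0)) (sym (ē-zero α≈0)))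
    (λ α≉0 → root (e-root α≉0))
    where
    root : ∀ {γ} → CubeRootOfUnity γ → conj γ ≡ γ * γ
    root (inj₁ refl)        = refl
    root (inj₂ (inj₁ refl)) = refl
    root (inj₂ (inj₂ refl)) = refl

  N-J : N J ≡ + suc (3 ℕ.* suc M)
  N-J = cong re (begin
    fromℤ (N J)                 ≡⟨ α*conj≡N J ⟨
    J * conj J                  ≡⟨ cong (J *_) (conj-sum (λ i → e (rep i) * e (1D - rep i))) ⟩
    J * ∑ (λ α → conj (e α * e (1D - α)))
      ≡⟨ cong (J *_) (∑-cong (λ α → trans (conj-* (e α) (e (1D - α)))
           (cong₂ _*_ (conj-e α) (conj-e (1D - α))))) ⟩
    J * J̄                       ≡⟨ J*J̄ ⟩
    fromℕ (suc (3 ℕ.* suc M))   ∎)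
    where open ≡-Reasoning

-- The cubic residue character

N≡1⇒∣1 : ∀ π → N π ≡ 1ℤ → π ∣ 1D
N≡1⇒∣1 π Nπ≡1 = conj π , trans (Dᵣ.*-comm (conj π) π) (trans (α*conj≡N π) (cong fromℤ Nπ≡1))

module CubicResidue {π : D} {M : ℕ} (π-prime : Prime π) (Nπ≢3 : N π ≢ + 3)
                    (size : ∣ N π ∣ ≡ suc (3 ℕ.* suc M)) where
  open Congruence π
  open PrimeModulus π-prime

  system : ResidueSystem π (suc (3 ℕ.* suc M))
  system = subst (ResidueSystem π) size (residueSystem π (Prime.p≉0 π-prime))

  open FiniteField π-prime system

  cubicExponent≡ : cubicExponent π ≡ suc M
  cubicExponent≡ = trans (cong (λ k → (k ℕ.∸ 1) ℕ./ 3) size)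
    (trans (cong (ℕ._/ 3) (ℕ.*-comm 3 (suc M))) (ℕ.m*n/n≡m (suc M) 3))

  χ-value : ∀ {α γ} → ¬ α ≈ 0D → CubeRootOfUnity γ → α ^ suc M ≈ γ → χ π α ≡ γ
  χ-value {α} {γ} α≉0 γ-root [ p ] = χ-unique π-prime Nπ≢3 (λ π∣α → α≉0 (∣⇒≈0 π∣α)) γ-root
    (subst (λ k → π ∣ α ^ k - γ) (sym cubicExponent≡) p)

  -- By `fermat` the power y satisfies y³ ≡ 1, and y³ - 1 = (y - 1)(y - ω)(y - ω²) already holds in
  -- D, so the prime π divides one of the factors.
  power-root : ∀ {α} → ¬ α ≈ 0D → ∃[ γ ] CubeRootOfUnity γ × α ^ suc M ≈ γ
  power-root {α} α≉0 =
    ⊎.[ (λ p → 1D , inj₁ refl , -≈0⇒≈ p) , (λ q →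
      ⊎.[ (λ p → ω , inj₂ (inj₁ refl) , -≈0⇒≈ p)
        , (λ p → ω ^ 2 , inj₂ (inj₂ refl) , -≈0⇒≈ p) ]′
      (*≈0⇒ (y - ω) (y - ω ^ 2) q)) ]′
    (*≈0⇒ (y - 1D) ((y - ω) * (y - ω ^ 2)) (≈-trans (≈-reflexive (eq y)) (≈⇒-≈0 y³≈1)))
    where
    y = α ^ suc M
    y³≈1 : y ^ 3 ≈ 1D
    y³≈1 = ≈-trans (≈-reflexive (trans (^-assocʳ α (suc M) 3) (cong (α ^_) (ℕ.*-comm (suc M) 3))))
                   (fermat α≉0)
    eq : ∀ y → (y - 1D) * ((y - ω) * (y - ω * (ω * 1D))) ≡ y * (y * (y * 1D)) - 1D
    eq = solve-∀ D-ring

  χ-power : ∀ α → χ π α ≈ α ^ suc M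
  χ-power α = byZero α
    (λ α≈0 → ≈-trans (≈-reflexive (χ-zero (≈0⇒∣ α≈0)))
      (≈-sym (≈-trans (*-cong α≈0 (≈-refl {α ^ M})) (≈-reflexive (Dᵣ.zeroˡ (α ^ M))))))
    (λ α≉0 → let (γ , γ-root , p) = power-root α≉0 in
      ≈-trans (≈-reflexive (χ-value α≉0 γ-root p)) (≈-sym p))

  χ-isCubicCharacter : IsCubicCharacter π (χ π)
  χ-isCubicCharacter = record
    { e-cong = λ {α} {β} α≈β → byZero α
        (λ α≈0 → trans (χ-zero (≈0⇒∣ α≈0)) (sym (χ-zero (≈0⇒∣ (≈-trans (≈-sym α≈β) α≈0)))))
        (λ α≉0 → let (γ , γ-root , p) = power-root α≉0 in
          trans (χ-value α≉0 γ-root p)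
            (sym (χ-value (λ β≈0 → α≉0 (≈-trans α≈β β≈0)) γ-root
              (≈-trans (≈-sym (^-cong (suc M) α≈β)) p))))
    ; e-* = λ α β → byZero α
        (λ α≈0 → trans
          (χ-zero (≈0⇒∣ (≈-trans (*-cong α≈0 (≈-refl {β})) (≈-reflexive (Dᵣ.zeroˡ β)))))
          (sym (trans (cong (_* χ π β) (χ-zero (≈0⇒∣ α≈0))) (Dᵣ.zeroˡ (χ π β)))))
        (λ α≉0 → byZero β
          (λ β≈0 → trans
            (χ-zero (≈0⇒∣ (≈-trans (*-cong (≈-refl {α}) β≈0) (≈-reflexive (Dᵣ.zeroʳ α)))))
            (sym (trans (cong (χ π α *_) (χ-zero (≈0⇒∣ β≈0))) (Dᵣ.zeroʳ (χ π α)))))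
          (λ β≉0 → let (γ , γ-root , p) = power-root α≉0
                       (δ , δ-root , q) = power-root β≉0 in
            trans (χ-value (*≉0 α≉0 β≉0) (CubeRootOfUnity-* γ-root δ-root)
                (≈-trans (≈-reflexive (^-distrib-* α β (suc M))) (*-cong p q)))
              (sym (cong₂ _*_ (χ-value α≉0 γ-root p) (χ-value β≉0 δ-root q)))))
    ; e-zero = λ α≈0 → χ-zero (≈0⇒∣ α≈0)
    ; e-root = λ α≉0 → let (γ , γ-root , p) = power-root α≉0 in
        subst CubeRootOfUnity (sym (χ-value α≉0 γ-root p)) γ-root
    ; e-nontrivial = λ trivial → power-nontrivial (suc M) (ℕ.s≤s ℕ.z≤n)
        (ℕ.m<m+n (suc M) (ℕ.s≤s ℕ.z≤n))
        λ α α≉0 → ≈-trans (≈-sym (χ-power α)) (≈-reflexive (trivial α α≉0))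
    }

  open IsCubicCharacter χ-isCubicCharacter
  open JacobiSum {π} {M} π-prime system (χ π) χ-isCubicCharacter χ-power public

  ω-power-root : ∀ k → CubeRootOfUnity (ω ^ k)
  ω-power-root = CubeRootOfUnity-^ (inj₂ (inj₁ refl))

  ω≉0 : ¬ ω ≈ 0D
  ω≉0 p = 1≉0 (*-cong (≈-refl {ω ^ 2}) p)

  χ-ω : χ π ω ≡ ω ^ suc M
  χ-ω = χ-value ω≉0 (ω-power-root (suc M)) ≈-refl

  N≈0 : fromℕ (suc (3 ℕ.* suc M)) ≈ 0D
  N≈0 = ∣⇒≈0 (conj π , trans (Dᵣ.*-comm (conj π) π)
    (trans (α*conj≡N π) (cong fromℤ (trans (N-nonneg π) (cong +_ size)))))

  -- χ is evaluated on both sides of 3(1 + M) ≡ - 1, where 3 = - ω²(1 - ω)².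
  χ-exponent : let u = χ π (1D - ω) ; v = ω ^ suc M in
               CubeRootOfUnity u × χ π (fromℕ (suc M)) ≡ v * u
  χ-exponent = u-root , (begin
    -- By `relation`, E is inverse to (vu)²; inserting (vu)³ = 1 turns this into E = vu.
    E                                          ≡⟨ eq₂ E ⟩
    1D * 1D * E                                ≡⟨ cong₂ (λ x y → x * y * E) (cube≡1 v-root) (cube≡1 u-root) ⟨
    v * (v * v) * (u * (u * u)) * E            ≡⟨ eq₃ u v E ⟩
    v * u * (v * v * (u * u) * E)              ≡⟨ cong (v * u *_) relation ⟩
    v * u * 1D                                 ≡⟨ Dᵣ.*-identityʳ (v * u) ⟩
    v * u                                      ∎)
    where
    open ≡-Reasoning
    u v E : D
    u = χ π (1D - ω)
    v = ω ^ suc M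
    E = χ π (fromℕ (suc M))
    v-root = ω-power-root (suc M)
    eq₂ : ∀ x → x ≡ 1D * 1D * x
    eq₂ = solve-∀ D-ring
    eq₃ : ∀ u v e → v * (v * v) * (u * (u * u)) * e ≡ v * u * (v * v * (u * u) * e)
    eq₃ = solve-∀ D-ring
    eq₄ : ∀ x → ω * ω * ((1D - ω) * (1D - ω)) * x - 1D ≡ - (1D + 3D * x)
    eq₄ = solve-∀ D-ring
    relation : v * v * (u * u) * E ≡ 1D
    relation = begin
      v * v * (u * u) * E
        ≡⟨ cong (λ z → z * z * (u * u) * E) χ-ω ⟨
      χ π ω * χ π ω * (u * u) * E
        ≡⟨ cong₂ (λ x y → x * y * E) (e-* ω ω) (e-* (1D - ω) (1D - ω)) ⟨
      χ π (ω * ω) * χ π ((1D - ω) * (1D - ω)) * E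
        ≡⟨ cong (_* E) (e-* (ω * ω) ((1D - ω) * (1D - ω))) ⟨
      χ π (ω * ω * ((1D - ω) * (1D - ω))) * E
        ≡⟨ e-* (ω * ω * ((1D - ω) * (1D - ω))) (fromℕ (suc M)) ⟨
      χ π (ω * ω * ((1D - ω) * (1D - ω)) * fromℕ (suc M))
        ≡⟨ e-cong (-≈0⇒≈ {_} {1D} (≈-trans (≈-reflexive (trans (eq₄ (fromℕ (suc M)))
             (cong (λ z → - (1D + z)) (fromℕ-* 3 (suc M))))) (-‿cong N≈0))) ⟩
      χ π 1D
        ≡⟨ e-1 ⟩
      1D ∎
    -- The relation itself excludes π ∣ 1 - ω: then u, and with it the left side, would be 0.
    1-ω≉0 : ¬ 1D - ω ≈ 0D
    1-ω≉0 p = contradiction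
      (trans (sym relation) (trans (cong (λ z → v * v * (z * z) * E) (e-zero p)) (zero* (v * v) E)))
      λ ()
      where
      zero* : ∀ x y → x * (0D * 0D) * y ≡ 0D
      zero* = solve-∀ D-ring
    u-root : CubeRootOfUnity u
    u-root = e-root 1-ω≉0

-- Determination of χ (1 - ω)

3D-* : ∀ β → 3D * β ≡ (+ 3 ℤ.* re β +ω· + 3 ℤ.* im β)
3D-* (r +ω· s) = cong₂ _+ω·_ (eq₁ r s) (eq₂ r s)
  where
  eq₁ : ∀ r s → + 3 ℤ.* r ℤ.- 0ℤ ℤ.* s ≡ + 3 ℤ.* r
  eq₁ = ℤ-Solver.solve-∀
  eq₂ : ∀ r s → + 3 ℤ.* s ℤ.+ 0ℤ ℤ.* r ℤ.- 0ℤ ℤ.* s ≡ + 3 ℤ.* s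
  eq₂ = ℤ-Solver.solve-∀

-- The map x ↦ 1 + x(ω - 1) turns sums into products modulo 3, because (ω - 1)² = - 3ω.
module Linearisation where
  open Congruence 3D

  linear : ℤ → D
  linear x = 1D + fromℤ x * (ω - 1D)

  linear-* : ∀ {γ δ} x y → γ ≈ linear x → δ ≈ linear y → γ * δ ≈ linear (x ℤ.+ y)
  linear-* {γ} {δ} x y p q = ≈-trans (*-cong p q)
    [ - (ω * fromℤ x * fromℤ y) , sym (eq (fromℤ x) (fromℤ y)) ]
    where
    eq : ∀ x y → (1D + x * (ω - 1D)) * (1D + y * (ω - 1D)) - (1D + (x + y) * (ω - 1D)) ≡
                 - (ω * x * y) * 3D
    eq = solve-∀ D-ring

  ω^-linear : ∀ i → ω^ i ≈ linear i
  ω^-linear (+ zero)  = ≈-refl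
  ω^-linear (+ suc n) = linear-* {ω} {ω ^ n} 1ℤ (+ n) ≈-refl (ω^-linear (+ n))
  ω^-linear -[1+ n ]  = negative n
    where
    negative : ∀ n → (ω ^ 2) ^ suc n ≈ linear -[1+ n ]
    negative zero    = [ - 1D , refl ]
    negative (suc n) = linear-* {ω ^ 2} {(ω ^ 2) ^ suc n} -[1+ 0 ] -[1+ n ] [ - 1D , refl ] (negative n)

  linear-mod3 : ∀ x y z → x ≡ y ℤ.+ + 3 ℤ.* z → linear x ≈ linear y
  linear-mod3 x y z refl = [ fromℤ z * (ω - 1D) , sym (trans
    (cong (λ t → 1D + (fromℤ y + t) * (ω - 1D) - linear y) (sym (3D-* (fromℤ z))))
    (eq (fromℤ y) (fromℤ z))) ]
    where
    eq : ∀ y z → 1D + (y + 3D * z) * (ω - 1D) - (1D + y * (ω - 1D)) ≡ z * (ω - 1D) * 3D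
    eq = solve-∀ D-ring

  ω^-root : ∀ i → CubeRootOfUnity (ω^ i)
  ω^-root (+ n)    = CubeRootOfUnity-^ (inj₂ (inj₁ refl)) n
  ω^-root -[1+ n ] = CubeRootOfUnity-^ (inj₂ (inj₂ refl)) (suc n)

  -- Differences of distinct cube roots of unity have norm 3, whereas 3 has norm 9. The six cases
  -- are settled by evaluating `∣?`.
  roots-distinct : ∀ {γ δ} → CubeRootOfUnity γ → CubeRootOfUnity δ → γ ≈ δ → γ ≡ δ
  roots-distinct (inj₁ refl)        (inj₁ refl)        _     = refl
  roots-distinct (inj₁ refl)        (inj₂ (inj₁ refl)) [ p ] = contradiction p (from-no (3D ∣? 1D - ω))
  roots-distinct (inj₁ refl)        (inj₂ (inj₂ refl)) [ p ] = contradiction p (from-no (3D ∣? 1D - ω ^ 2))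
  roots-distinct (inj₂ (inj₁ refl)) (inj₁ refl)        [ p ] = contradiction p (from-no (3D ∣? ω - 1D))
  roots-distinct (inj₂ (inj₁ refl)) (inj₂ (inj₁ refl)) _     = refl
  roots-distinct (inj₂ (inj₁ refl)) (inj₂ (inj₂ refl)) [ p ] = contradiction p (from-no (3D ∣? ω - ω ^ 2))
  roots-distinct (inj₂ (inj₂ refl)) (inj₁ refl)        [ p ] = contradiction p (from-no (3D ∣? ω ^ 2 - 1D))
  roots-distinct (inj₂ (inj₂ refl)) (inj₂ (inj₁ refl)) [ p ] = contradiction p (from-no (3D ∣? ω ^ 2 - ω))
  roots-distinct (inj₂ (inj₂ refl)) (inj₂ (inj₂ refl)) _     = refl

primary-coordinates : ∀ π → Primary π → ∃[ β ] π ≡ 1D + 1D + 3D * β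
primary-coordinates π (β , p) = β , trans (eq₁ π) (trans (cong (λ z → z + (1D + 1D)) (sym p)) (eq₂ β))
  where
  eq₁ : ∀ π → π ≡ π - (1D + 1D) + (1D + 1D)
  eq₁ = solve-∀ D-ring
  eq₂ : ∀ β → β * 3D + (1D + 1D) ≡ 1D + 1D + 3D * β
  eq₂ = solve-∀ D-ring

-- The cubic exponent (N π - 1)/3 as a polynomial in r and s, where π = 2 + 3(r + sω).
normQuotient : D → ℤ
normQuotient (r +ω· s) =
  1ℤ ℤ.+ + 4 ℤ.* r ℤ.+ + 3 ℤ.* (r ℤ.* r) ℤ.- + 2 ℤ.* s ℤ.- + 3 ℤ.* (r ℤ.* s) ℤ.+ + 3 ℤ.* (s ℤ.* s)

N-primary : ∀ β → N (1D + 1D + 3D * β) ≡ 1ℤ ℤ.+ + 3 ℤ.* normQuotient β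
N-primary β = trans (cong (λ z → N (1D + 1D + z)) (3D-* β)) (eq (re β) (im β))
  where
  eq : ∀ r s →
    (+ 2 ℤ.+ + 3 ℤ.* r) ℤ.* (+ 2 ℤ.+ + 3 ℤ.* r) ℤ.- (+ 2 ℤ.+ + 3 ℤ.* r) ℤ.* (0ℤ ℤ.+ + 3 ℤ.* s)
      ℤ.+ (0ℤ ℤ.+ + 3 ℤ.* s) ℤ.* (0ℤ ℤ.+ + 3 ℤ.* s) ≡
    1ℤ ℤ.+ + 3 ℤ.* (1ℤ ℤ.+ + 4 ℤ.* r ℤ.+ + 3 ℤ.* (r ℤ.* r) ℤ.- + 2 ℤ.* s ℤ.- + 3 ℤ.* (r ℤ.* s) ℤ.+ + 3 ℤ.* (s ℤ.* s))
  eq = ℤ-Solver.solve-∀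

1+3k-nonneg : ∀ {n} k → + n ≡ 1ℤ ℤ.+ + 3 ℤ.* k → ∃[ m ] k ≡ + m × n ≡ suc (3 ℕ.* m)
1+3k-nonneg (+ m)    p = m , refl , ℤ.+-injective (trans p (cong (λ z → 1ℤ ℤ.+ z) (sym (ℤ.pos-* 3 m))))
1+3k-nonneg -[1+ m ] p rewrite ℕ.+-suc m (m ℕ.+ suc (m ℕ.+ 0)) | ℕ.+-suc m (m ℕ.+ 0) with () ← p

-- By the parallelogram law N (1 + 3ρ + 1) + N (3ρ) = 4, where N (3ρ) = 9 N ρ.
unit≡1 : ∀ ρ → N (1D + 3D * ρ) ≡ 1ℤ → ρ ≡ 0D
unit≡1 ρ N≡1 = N≡0⇒≡0 ρ (trans (N-nonneg ρ) (cong +_ (small ∣ N (1D + 3D * ρ + 1D) ∣ ∣ N ρ ∣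
    (ℤ.+-injective (trans (ℤ.pos-+ ∣ N (1D + 3D * ρ + 1D) ∣ (9 ℕ.* ∣ N ρ ∣))
      (trans (cong₂ ℤ._+_ (sym (N-nonneg (1D + 3D * ρ + 1D)))
          (trans (ℤ.pos-* 9 ∣ N ρ ∣) (cong (+ 9 ℤ.*_) (sym (N-nonneg ρ)))))
        (trans (parallelogram ρ) (cong (λ z → + 2 ℤ.* z ℤ.+ + 2) N≡1))))))))
  where
  small : ∀ a b → a ℕ.+ 9 ℕ.* b ≡ 4 → b ≡ 0
  small a zero    _ = refl
  small a (suc b) p = contradiction (ℕ.≤-trans (ℕ.m≤m+n 9 _)
    (ℕ.≤-trans (ℕ.≤-reflexive (sym (ℕ.*-suc 9 b))) (ℕ.≤-trans (ℕ.m≤n+m (9 ℕ.* suc b) a) (ℕ.≤-reflexive p)))) (from-no (9 ℕ.≤? 4))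
  parallelogram : ∀ ρ → N (1D + 3D * ρ + 1D) ℤ.+ + 9 ℤ.* N ρ ≡ + 2 ℤ.* N (1D + 3D * ρ) ℤ.+ + 2
  parallelogram ρ = trans (cong (λ z → N (1D + z + 1D) ℤ.+ + 9 ℤ.* N ρ) (3D-* ρ))
    (trans (eq (re ρ) (im ρ)) (sym (cong (λ z → + 2 ℤ.* N (1D + z) ℤ.+ + 2) (3D-* ρ))))
    where
    eq : ∀ r s →
      ((1ℤ ℤ.+ + 3 ℤ.* r ℤ.+ 1ℤ) ℤ.* (1ℤ ℤ.+ + 3 ℤ.* r ℤ.+ 1ℤ)
        ℤ.- (1ℤ ℤ.+ + 3 ℤ.* r ℤ.+ 1ℤ) ℤ.* (0ℤ ℤ.+ + 3 ℤ.* s ℤ.+ 0ℤ)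
        ℤ.+ (0ℤ ℤ.+ + 3 ℤ.* s ℤ.+ 0ℤ) ℤ.* (0ℤ ℤ.+ + 3 ℤ.* s ℤ.+ 0ℤ))
        ℤ.+ + 9 ℤ.* (r ℤ.* r ℤ.- r ℤ.* s ℤ.+ s ℤ.* s) ≡
      + 2 ℤ.* ((1ℤ ℤ.+ + 3 ℤ.* r) ℤ.* (1ℤ ℤ.+ + 3 ℤ.* r)
        ℤ.- (1ℤ ℤ.+ + 3 ℤ.* r) ℤ.* (0ℤ ℤ.+ + 3 ℤ.* s)
        ℤ.+ (0ℤ ℤ.+ + 3 ℤ.* s) ℤ.* (0ℤ ℤ.+ + 3 ℤ.* s)) ℤ.+ + 2
    eq = ℤ-Solver.solve-∀

divides⇒∃ : ∀ {α β} → α ∣ β → ∃[ κ ] κ * α ≡ β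
divides⇒∃ (κ , p) = κ , p

-- A condition on `re π` alone covers both cases of the theorem, since q and a are both the real
-- coordinate of π. With π = 2 + 3(r + sω) it says m = 1 + r.
χ-1-ω : ∀ π → Prime π → Primary π → N π ≢ + 3 → ∀ m → re π ≡ + 3 ℤ.* m ℤ.- + 1 →
        χ π (1D - ω) ≡ ω^ (+ 2 ℤ.* m)
χ-1-ω π π-prime π-primary Nπ≢3 m re≡ = byQuotient (1+3k-nonneg (normQuotient β)
  (trans (sym (N-nonneg π)) (trans (cong N π≡) (N-primary β))))
  where
  β = proj₁ (primary-coordinates π π-primary)
  π≡ : π ≡ 1D + 1D + 3D * β
  π≡ = proj₂ (primary-coordinates π π-primary)
  r = re β
  s = im β

  m≡ : m ≡ 1ℤ ℤ.+ r
  m≡ = ℤ.*-cancelˡ-≡ (+ 3) m (1ℤ ℤ.+ r)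
    (trans (eq₁ m) (trans (cong (λ x → x ℤ.+ 1ℤ)
      (trans (sym re≡) (trans (cong re π≡) (cong (λ z → re (1D + 1D + z)) (3D-* β))))) (eq₂ r)))
    where
    eq₁ : ∀ m → + 3 ℤ.* m ≡ + 3 ℤ.* m ℤ.- + 1 ℤ.+ 1ℤ
    eq₁ = ℤ-Solver.solve-∀
    eq₂ : ∀ r → + 2 ℤ.+ + 3 ℤ.* r ℤ.+ 1ℤ ≡ + 3 ℤ.* (1ℤ ℤ.+ r)
    eq₂ = ℤ-Solver.solve-∀

  module _ (M : ℕ) (k≡ : normQuotient β ≡ + suc M) (size : ∣ N π ∣ ≡ suc (3 ℕ.* suc M)) where
    open CubicResidue {π} {M} π-prime Nπ≢3 size
    open Linearisation
    open Congruence 3D using (_≈_; [_]; ≈-refl; ≈-trans; ≈-sym; ≈-reflexive)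

    E T u v δ κ ρ : D
    E = χ π (fromℕ (suc M))
    u = χ π (1D - ω)
    v = ω ^ suc M
    δ = proj₁ J-mod9
    T = E - 1D + 3D * δ + fromℕ M
    π∣J = divides⇒∃ (Congruence.≈0⇒∣ π J≈0)
    κ = proj₁ π∣J
    -- Solves κ(2 + 3β) = 2 + 3T for κ = 1 + 3ρ: doubling gives 4κ = 4 + 6T - 6κβ, as 2 is its own
    -- inverse modulo 3, and then 3κ is subtracted.
    ρ = 1D + (1D + 1D) * T - (1D + 1D) * (κ * β) - κ

    κ*π≡J : κ * π ≡ J
    κ*π≡J = proj₂ π∣J

    κ≡ : 1D + 3D * ρ ≡ κ
    κ≡ = trans (eq₁ κ β T) (trans (cong (λ z → (1D + 1D) * ((1D + 1D + 3D * T) - z) + κ)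
      (trans (cong (κ *_) (sym π≡)) (trans κ*π≡J (proj₂ J-mod9)))) (eq₂ (1D + 1D + 3D * T) κ))
      where
      eq₁ : ∀ κ β T → 1D + 3D * (1D + (1D + 1D) * T - (1D + 1D) * (κ * β) - κ) ≡
                      (1D + 1D) * ((1D + 1D + 3D * T) - κ * (1D + 1D + 3D * β)) + κ
      eq₁ = solve-∀ D-ring
      eq₂ : ∀ x κ → (1D + 1D) * (x - x) + κ ≡ κ
      eq₂ = solve-∀ D-ring

    N-π : N π ≡ + suc (3 ℕ.* suc M)
    N-π = trans (N-nonneg π) (cong +_ size)

    N-κ : N κ ≡ 1ℤ
    N-κ = ℤ.*-cancelʳ-≡ (N κ) 1ℤ (+ suc (3 ℕ.* suc M)) (begin
      N κ ℤ.* + suc (3 ℕ.* suc M)  ≡⟨ cong (N κ ℤ.*_) N-π ⟨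
      N κ ℤ.* N π                  ≡⟨ N-* κ π ⟨
      N (κ * π)                    ≡⟨ cong N κ*π≡J ⟩
      N J                          ≡⟨ N-J ⟩
      + suc (3 ℕ.* suc M)          ≡⟨ ℤ.*-identityˡ (+ suc (3 ℕ.* suc M)) ⟨
      1ℤ ℤ.* + suc (3 ℕ.* suc M)   ∎)
      where open ≡-Reasoning

    π≡J : π ≡ J
    π≡J = trans (sym (Dᵣ.*-identityˡ π)) (trans (cong (_* π) 1≡κ) κ*π≡J)
      where
      1≡κ : 1D ≡ κ
      1≡κ = trans (cong (λ z → 1D + 3D * z) (sym (unit≡1 ρ (trans (cong N κ≡) N-κ)))) κ≡

    β≡T : β ≡ T
    β≡T = D-*-cancelˡ 3D β T (λ ()) (trans (eq (3D * β))
      (trans (cong (λ z → z - (1D + 1D)) (trans (sym π≡) (trans π≡J (proj₂ J-mod9)))) (sym (eq (3D * T)))))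
      where
      eq : ∀ x → x ≡ 1D + 1D + x - (1D + 1D)
      eq = solve-∀ D-ring

    -- By `χ-exponent` vu is E, and E ≡ T + 1 - M modulo 3. As T = β = r + sω and M ≡ r + s, this is
    -- 1 + s(ω - 1), so vu plays the part of ω^s.
    vu-linear : v * u ≈ linear s
    vu-linear = [ - (fromℤ μ + δ) , sym (begin
      v * u - linear s
        ≡⟨ cong (λ z → z - linear s) (proj₂ χ-exponent) ⟨
      E - linear s
        ≡⟨ eq₁ E δ (fromℕ M) (linear s) ⟩
      T + 1D - 3D * δ - fromℕ M - linear s
        ≡⟨ cong₂ (λ x y → x + 1D - 3D * δ - y - linear s) (trans (sym β≡T) coordinates) M̂≡ ⟩
      fromℤ r + fromℤ s * ω + 1D - 3D * δ - (fromℤ r + fromℤ s + 3D * fromℤ μ) - linear s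
        ≡⟨ eq₂ (fromℤ r) (fromℤ s) δ (fromℤ μ) ⟩
      - (fromℤ μ + δ) * 3D ∎) ]
      where
      open ≡-Reasoning
      -- Chosen so that M = r + s + 3μ, as follows from `normQuotient` being M + 1.
      μ = r ℤ.+ r ℤ.* r ℤ.- s ℤ.- r ℤ.* s ℤ.+ s ℤ.* s
      coordinates : β ≡ fromℤ r + fromℤ s * ω
      coordinates = cong₂ _+ω·_ (eq₃ r s) (eq₄ s)
        where
        eq₃ : ∀ r s → r ≡ r ℤ.+ (s ℤ.* 0ℤ ℤ.- 0ℤ ℤ.* 1ℤ)
        eq₃ = ℤ-Solver.solve-∀
        eq₄ : ∀ s → s ≡ 0ℤ ℤ.+ (s ℤ.* 1ℤ ℤ.+ 0ℤ ℤ.* 0ℤ ℤ.- 0ℤ ℤ.* 1ℤ)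
        eq₄ = ℤ-Solver.solve-∀
      M̂≡ : fromℕ M ≡ fromℤ r + fromℤ s + 3D * fromℤ μ
      M̂≡ = trans (cong fromℤ (trans (cong (λ z → ℤ.-1ℤ ℤ.+ z) (sym k≡)) (eq₅ r s)))
        (cong (λ z → fromℤ r + fromℤ s + z) (sym (3D-* (fromℤ μ))))
        where
        eq₅ : ∀ r s →
          ℤ.-1ℤ ℤ.+ (1ℤ ℤ.+ + 4 ℤ.* r ℤ.+ + 3 ℤ.* (r ℤ.* r) ℤ.- + 2 ℤ.* s ℤ.- + 3 ℤ.* (r ℤ.* s) ℤ.+ + 3 ℤ.* (s ℤ.* s)) ≡
          r ℤ.+ s ℤ.+ + 3 ℤ.* (r ℤ.+ r ℤ.* r ℤ.- s ℤ.- r ℤ.* s ℤ.+ s ℤ.* s)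
        eq₅ = ℤ-Solver.solve-∀
      eq₁ : ∀ e δ m l → e - l ≡ e - 1D + 3D * δ + m + 1D - 3D * δ - m - l
      eq₁ = solve-∀ D-ring
      eq₂ : ∀ r s δ μ → r + s * ω + 1D - 3D * δ - (r + s + 3D * μ) - (1D + s * (ω - 1D)) ≡ - (μ + δ) * 3D
      eq₂ = solve-∀ D-ring

    -- Since v³ = 1, u = (vu)v², which has exponent s + 2(M + 1). Modulo 3, M + 1 ≡ 1 + r + s, so
    -- the s cancels and 2(1 + r) = 2m remains.
    u-linear : u ≈ linear (+ 2 ℤ.* m)
    u-linear = ≈-trans (≈-reflexive (begin
        u                ≡⟨ Dᵣ.*-identityˡ u ⟨
        1D * u           ≡⟨ cong (_* u) (cube≡1 (ω-power-root (suc M))) ⟨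
        v * (v * v) * u  ≡⟨ eq₁ u v ⟩
        v * u * (v * v)  ∎))
      (≈-trans (linear-* {v * u} {v * v} s (+ suc M ℤ.+ + suc M) vu-linear
          (linear-* {v} {v} (+ suc M) (+ suc M) (ω^-linear (+ suc M)) (ω^-linear (+ suc M))))
        (linear-mod3 (s ℤ.+ (+ suc M ℤ.+ + suc M)) (+ 2 ℤ.* m)
          -- The third part of s + 2(M + 1) - 2m, expanded in r and s.
          (+ 2 ℤ.* r ℤ.+ + 2 ℤ.* (r ℤ.* r) ℤ.- s ℤ.- + 2 ℤ.* (r ℤ.* s) ℤ.+ + 2 ℤ.* (s ℤ.* s))
          (trans (cong (λ z → s ℤ.+ (z ℤ.+ z)) (sym k≡)) (trans (eq₂ r s)
            (cong (λ z → + 2 ℤ.* z ℤ.+ + 3 ℤ.* (+ 2 ℤ.* r ℤ.+ + 2 ℤ.* (r ℤ.* r) ℤ.- s ℤ.- + 2 ℤ.* (r ℤ.* s) ℤ.+ + 2 ℤ.* (s ℤ.* s)))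
              (sym m≡))))))
      where
      open ≡-Reasoning
      eq₁ : ∀ u v → v * (v * v) * u ≡ v * u * (v * v)
      eq₁ = solve-∀ D-ring
      eq₂ : ∀ r s →
        let k = 1ℤ ℤ.+ + 4 ℤ.* r ℤ.+ + 3 ℤ.* (r ℤ.* r) ℤ.- + 2 ℤ.* s ℤ.- + 3 ℤ.* (r ℤ.* s) ℤ.+ + 3 ℤ.* (s ℤ.* s) in
        s ℤ.+ (k ℤ.+ k) ≡
        + 2 ℤ.* (1ℤ ℤ.+ r) ℤ.+ + 3 ℤ.* (+ 2 ℤ.* r ℤ.+ + 2 ℤ.* (r ℤ.* r) ℤ.- s ℤ.- + 2 ℤ.* (r ℤ.* s) ℤ.+ + 2 ℤ.* (s ℤ.* s))
      eq₂ = ℤ-Solver.solve-∀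

    conclusion : u ≡ ω^ (+ 2 ℤ.* m)
    conclusion = roots-distinct (proj₁ χ-exponent) (ω^-root (+ 2 ℤ.* m))
      (≈-trans u-linear (≈-sym (ω^-linear (+ 2 ℤ.* m))))

  byQuotient : ∃[ k ] normQuotient β ≡ + k × ∣ N π ∣ ≡ suc (3 ℕ.* k) → χ π (1D - ω) ≡ ω^ (+ 2 ℤ.* m)
  byQuotient (zero  , _  , size) = contradiction
    (N≡1⇒∣1 π (trans (N-nonneg π) (cong +_ size))) (Prime.p∤1 π-prime)
  byQuotient (suc M , k≡ , size) = conclusion M k≡ size

theorem3p15 : (π : D) → Prime π → Primary π → N π ≢ + 3 →
    ((q m : ℤ) → RationalPrime q → π ≡ fromℤ q → q ≡ + 3 ℤ.* m ℤ.- + 1 →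
    χ π (1D - ω) ≡ ω^ (+ 2 ℤ.* m))
    × ((a b m : ℤ) → ¬ IsRationalPrime π → π ≡ fromℤ a + fromℤ b * ω → a ≡ + 3 ℤ.* m ℤ.- + 1 →
    χ π (1D - ω) ≡ ω^ (+ 2 ℤ.* m))
theorem3p15 π π-prime π-primary Nπ≢3 =
    (λ q m _ π≡q q≡ → χ-1-ω π π-prime π-primary Nπ≢3 m (trans (cong re π≡q) q≡))
  , (λ a b m _ π≡a+bω a≡ → χ-1-ω π π-prime π-primary Nπ≢3 m
      (trans (cong re π≡a+bω) (trans (real-part a b) a≡)))
  where
  real-part : ∀ a b → a ℤ.+ (b ℤ.* 0ℤ ℤ.- 0ℤ ℤ.* 1ℤ) ≡ a
  real-part = ℤ-Solver.solve-∀
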